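{- Let $G=\mathbb{F}_p^n$, let $k,t$ be positive integers with $t\geq 20k$ and let $B\subset G^2$ be a bilinear Bohr set of codimension $k$ and rank $t$. Then every function $\phi:B\to G$ that is affine in each variable separately can be extended to a function defined on all of $G^2$ that is affine in each variable separately.
   Context: $p$ is a prime. A bi-affine map $\beta:G^2\to\mathbb{F}_p^k$ is a map affine in each variable separately; its coordinates have the form $\beta_i(x,y)=x\cdot T_iy+x\cdot a_i+b_i\cdot y+\lambda_i$ with $T_i$ linear, and its rank is the minimum over non-zero $u\in\mathbb{F}_p^k$ of the rank of $\sum_iu_iT_i$. A bilinear Bohr set of codimension $k$ is a set $\{(x,y)\in G^2:\beta(x,y)=z\}$ with $\beta:G^2\to\mathbb{F}_p^k$ bi-affine and $z\in\mathbb{F}_p^k$; its rank is the highest rank of a bi-affine map of which it is such a level set. A function $\phi$ on $B$ is affine in each variable separately if for each $x$ the map $y\mapsto\phi(x,y)$ on $\{y:(x,y)\in B\}$ is the restriction of an affine map, and for each $y$ the map $x\mapsto\phi(x,y)$ on $\{x:(x,y)\in B\}$ is the restriction of an affine map. -}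

module Defs where

open import Data.Nat using (ℕ; zero; suc; _+_; _*_; _≤_; NonZero)
open import Data.Nat.DivMod using (_mod_)
open import Data.Fin using (Fin; toℕ)
open import Data.Vec using (Vec; []; _∷_; map; zipWith; foldr; replicate; lookup; tabulate)
open import Data.Product using (Σ; ∃; _×_; _,_)
open import Relation.Binary.PropositionalEquality using (_≡_)
open import Relation.Nullary using (¬_)
open import Data.Unit using (⊤)

module _ (p : ℕ) .{{_ : NonZero p}} where

  F : Set
  F = Fin p

  _+F_ : F → F → F
  a +F b = (toℕ a + toℕ b) mod p

  _*F_ : F → F → F
  a *F b = (toℕ a * toℕ b) mod p

  0F : F
  0F = 0 mod p

  G : ℕ → Set
  G n = Vec F n

  0G : (n : ℕ) → G n
  0G n = replicate n 0F

  _+G_ : {n : ℕ} → G n → G n → G n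
  u +G v = zipWith _+F_ u v

  _·G_ : {n : ℕ} → F → G n → G n
  c ·G v = map (c *F_) v

  dot : {n : ℕ} → G n → G n → F
  dot x y = foldr (λ _ → F) _+F_ 0F (zipWith _*F_ x y)

  Mat : ℕ → ℕ → Set
  Mat m n = Vec (G n) m

  apply : {m n : ℕ} → Mat m n → G n → G m
  apply T y = map (λ row → dot row y) T

  0M : (m n : ℕ) → Mat m n
  0M m n = replicate m (0G n)

  _+M_ : {m n : ℕ} → Mat m n → Mat m n → Mat m n
  S +M T = zipWith _+G_ S T

  _·M_ : {m n : ℕ} → F → Mat m n → Mat m n
  c ·M T = map (c ·G_) T

  lincomb : {r n : ℕ} → Vec F r → Vec (G n) r → G n
  lincomb {n = n} [] [] = 0G n
  lincomb (c ∷ cs) (v ∷ vs) = (c ·G v) +G lincomb cs vs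

  LinIndep : {r n : ℕ} → Vec (G n) r → Set
  LinIndep {r} v = (c : Vec F r) → lincomb c v ≡ 0G _ → c ≡ replicate r 0F

  SpansImage : {r m n : ℕ} → Vec (G m) r → Mat m n → Set
  SpansImage {r} {m} {n} v T =
    ((y : G n) → Σ (Vec F r) (λ c → apply T y ≡ lincomb c v))
    × ((c : Vec F r) → Σ (G n) (λ y → apply T y ≡ lincomb c v))

  HasRank : {m n : ℕ} → Mat m n → ℕ → Set
  HasRank {m} T r = Σ (Vec (G m) r) (λ v → LinIndep v × SpansImage v T)

  -- bi-affine map β : G n × G n → F_p^k given by its coordinates
  -- β_i(x,y) = x · T_i y + x · a_i + b_i · y + λ_i
  record BiAffine (n k : ℕ) : Set where
    constructor biAffine
    field
      Ts  : Vec (Mat n n) k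
      as  : Vec (G n) k
      bs  : Vec (G n) k
      lam : Vec F k

  evalβ : {n k : ℕ} → BiAffine n k → G n → G n → Vec F k
  evalβ (biAffine Ts as bs lam) x y =
    tabulate (λ i → ((dot x (apply (lookup Ts i) y) +F dot x (lookup as i))
                      +F dot (lookup bs i) y) +F lookup lam i)

  combT : {n k : ℕ} → Vec F k → BiAffine n k → Mat n n
  combT {n} u β = go u (BiAffine.Ts β)
    where
      go : {j : ℕ} → Vec F j → Vec (Mat n n) j → Mat n n
      go [] [] = 0M n n
      go (c ∷ cs) (T ∷ Ts) = (c ·M T) +M go cs Ts

  NonZeroVec : {k : ℕ} → Vec F k → Set
  NonZeroVec {k} u = ¬ (u ≡ replicate k 0F)

  BiAffineRank : {n k : ℕ} → BiAffine n k → ℕ → Set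
  BiAffineRank {n} {k} β t =
    Σ (Vec F k) (λ u → NonZeroVec u × HasRank (combT u β) t)
    × ((u : Vec F k) → NonZeroVec u → (r : ℕ) → HasRank (combT u β) r → t ≤ r)

  InBohr : {n k : ℕ} → BiAffine n k → Vec F k → G n → G n → Set
  InBohr β z x y = evalβ β x y ≡ z

  affApp : {n : ℕ} → Mat n n → G n → G n → G n
  affApp A c y = apply A y +G c

  -- φ (defined at least on S ⊆ G²) is affine in each variable separately on S
  AffineEachVar : {n : ℕ} → (G n → G n → Set) → (G n → G n → G n) → Set
  AffineEachVar {n} S φ =
    ((x : G n) → Σ (Mat n n) (λ A → Σ (G n) (λ c →
        (y : G n) → S x y → φ x y ≡ affApp A c y)))
    × ((y : G n) → Σ (Mat n n) (λ A → Σ (G n) (λ c →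
        (x : G n) → S x y → φ x y ≡ affApp A c x)))

  Everywhere : {n : ℕ} → G n → G n → Set
  Everywhere _ _ = ⊤

{-# OPTIONS --safe #-}
module Submission where

-- For fixed y the map φ(·,y) extends to an affine function F(y) on G, unique up to the k-dimensional space
-- S(y) spanned by the functions β_i(·,y) - z_i, provided their linear parts are independent. If o, y, y' are
-- generic, then F(y + y' - o) - F(y) - F(y') + F(o) lies in S(o) + S(y) + S(y'), because it vanishes where
-- these three spaces do. Once F(o) is fixed, this error can be absorbed into the choices of F(y), F(y') and
-- F(y + y' - o) in exactly one way. The resulting choice of F(y) does not depend on y', and it satisfies
-- F(y + y' - o) = F(y) + F(y') - F(o) for generic y, y', so it extends to an affine map y ↦ M(y). For any
-- (x,y) in B there are generic y₁, y₂ with y, y₁, y₂ and y₁ + y₂ - y all in the fibre over x, which gives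
-- M(y)(x) = φ(x,y₁) + φ(x,y₂) - φ(x,y₁ + y₂ - y) = φ(x,y). Generic points exist because the rank is large
-- compared with the number of coefficients in the linear relations to be avoided.

open import Defs
open import Data.Nat using (ℕ; _≤_; _*_; NonZero)
open import Data.Nat.Primality using (Prime)
open import Data.Vec using (Vec)
open import Data.Product using (Σ; _×_)
open import Relation.Binary.PropositionalEquality using (_≡_)

open import Algebra.Bundles using (AbelianGroup; CommutativeSemiring)
import Algebra.Properties.AbelianGroup as AbelianGroupProperties
import Algebra.Solver.Ring.NaturalCoefficients.Default as NaturalCoefficients
open import Algebra.Structures using (IsAbelianGroup)
open import Data.Fin as Fin using (Fin; toℕ)
open import Data.Fin.Properties using (toℕ-fromℕ<; toℕ-injective; toℕ<n; combine-injective; combine-remQuot; injective⇒≤)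
import Data.Nat as ℕ
open import Data.Nat using (zero; suc; _∸_)
open import Data.Nat.Coprimality using (prime⇒coprime; coprime-Bézout)
open import Data.Nat.DivMod using (_mod_; _%_; %-distribˡ-+; %-distribˡ-*; m<n⇒m%n≡m; n%n≡0)
open import Data.Nat.GCD using (module Bézout)
open import Data.Nat.Primality using (prime⇒nonTrivial)
import Data.Nat.Properties as ℕₚ
open import Data.Product using (∃; _,_; proj₁; proj₂)
open import Data.Sum using (_⊎_; inj₁; inj₂)
import Data.Sum as Sum
open import Data.Vec using ([]; _∷_; _++_; concat; drop; head; lookup; map; replicate; tabulate; tail; take; zipWith)
open import Data.Vec.Properties using (++-injective; ∷-injective; ≡-dec; lookup-map; lookup-zipWith; lookup∘tabulate; map-++; tabulate-cong; tabulate-∘; tabulate∘lookup; take++drop≡id; zipWith-assoc; zipWith-comm; zipWith-identityʳ; zipWith-identityˡ; zipWith-inverseʳ; zipWith-inverseˡ)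
open import Function using (_∘_)
open import Relation.Binary.PropositionalEquality using (_≢_; refl; sym; trans; cong; cong₂; subst; subst₂; setoid; isMagma; module ≡-Reasoning)
import Relation.Binary.Reflection as Reflection
open import Relation.Nullary using (contradiction; yes; no)

open ≡-Reasoning

-- Independence is always demanded modulo constants. If a non-zero constant lay in the span of some
-- of these functions, they would have no common zero and vanishing there would say nothing;
-- independent linear parts exclude this.
--
-- Both uniqueness claims come from describing one error twice. Two lifts at y differ by an element
-- of S(y); around a suitable parallelogram the same difference lies in another explicit span.
-- Inside a jointly independent system the coefficients can be compared, and they vanish. Points
-- that are not jointly generic are compared through a further point that is generic with respect to
-- all of them.
--
-- F has no preferred value at a degenerate y. With y = o + d and `φ` normalised so that F(o) = 0,
-- the value of the additive map at d is therefore F(o + d + e) - F(o + e) for generic e. The point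
-- o need not lie in the fibre over a given x, so the final check has to use a parallelogram inside
-- that fibre.
--
-- Genericity is proved by counting: if every candidate were bad, a vector space would inject into
-- one of smaller dimension.

abelianGroup : {A : Set} {_∙_ : A → A → A} {0# : A} {inv : A → A} →
  IsAbelianGroup _≡_ _∙_ 0# inv → AbelianGroup _ _
abelianGroup isAbelianGroup = record { isAbelianGroup = isAbelianGroup }

-- Identities in abelian groups by normalisation.

module AbelianGroupSolver {A : Set} {_∙_ : A → A → A} {0# : A} {inv : A → A}
  (isAbelianGroup : IsAbelianGroup _≡_ _∙_ 0# inv) where

  open IsAbelianGroup isAbelianGroup using (assoc; comm; identityˡ; identityʳ; inverseʳ)
  open AbelianGroupProperties (abelianGroup isAbelianGroup) using (⁻¹-∙-comm; ε⁻¹≈ε; ⁻¹-involutive)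

  infixl 6 _+_ _:+_ _:-_
  infix 8 -_ :-_

  _+_ : A → A → A
  _+_ = _∙_

  -_ : A → A
  -_ = inv

  data Expr (n : ℕ) : Set where
    var  : Fin n → Expr n
    :0   : Expr n
    _:+_ : Expr n → Expr n → Expr n
    :-_  : Expr n → Expr n

  _:-_ : ∀ {n} → Expr n → Expr n → Expr n
  e :- f = e :+ :- f

  ⟦_⟧ : ∀ {n} → Expr n → Vec A n → A
  ⟦ var i ⟧ ρ = lookup ρ i
  ⟦ :0 ⟧ ρ = 0#
  ⟦ e :+ f ⟧ ρ = ⟦ e ⟧ ρ + ⟦ f ⟧ ρ
  ⟦ :- e ⟧ ρ = - ⟦ e ⟧ ρ

  infixr 7 _×′_

  _×′_ : ℕ → A → A
  zero ×′ a = 0#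
  suc m ×′ a = a + (m ×′ a)

  lin : ∀ {n} → Vec ℕ n → Vec A n → A
  lin [] [] = 0#
  lin (m ∷ ms) (a ∷ ρ) = (m ×′ a) + lin ms ρ

  interchange : ∀ a b c d → (a + b) + (c + d) ≡ (a + c) + (b + d)
  interchange a b c d = begin
    (a + b) + (c + d) ≡⟨ assoc a b (c + d) ⟩
    a + (b + (c + d)) ≡⟨ cong (a +_) (trans (sym (assoc b c d)) (trans (cong (_+ d) (comm b c)) (assoc c b d))) ⟩
    a + (c + (b + d)) ≡⟨ sym (assoc a c (b + d)) ⟩
    (a + c) + (b + d) ∎

  ×′-+ : ∀ m l a → (m ℕ.+ l) ×′ a ≡ (m ×′ a) + (l ×′ a)
  ×′-+ zero l a = sym (identityˡ _)
  ×′-+ (suc m) l a = trans (cong (a +_) (×′-+ m l a)) (sym (assoc a _ _))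

  lin-+ : ∀ {n} (u v : Vec ℕ n) ρ → lin (zipWith ℕ._+_ u v) ρ ≡ lin u ρ + lin v ρ
  lin-+ [] [] [] = sym (identityˡ 0#)
  lin-+ (m ∷ u) (l ∷ v) (a ∷ ρ) =
    trans (cong₂ _+_ (×′-+ m l a) (lin-+ u v ρ)) (interchange (m ×′ a) (l ×′ a) (lin u ρ) (lin v ρ))

  lin-0 : ∀ {n} (ρ : Vec A n) → lin (replicate n 0) ρ ≡ 0#
  lin-0 [] = refl
  lin-0 (a ∷ ρ) = trans (identityˡ _) (lin-0 ρ)

  unit : ∀ {n} → Fin n → Vec ℕ n
  unit Fin.zero = 1 ∷ replicate _ 0
  unit (Fin.suc i) = 0 ∷ unit i

  lin-unit : ∀ {n} (i : Fin n) ρ → lin (unit i) ρ ≡ lookup ρ i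
  lin-unit Fin.zero (a ∷ ρ) = trans (cong₂ _+_ (identityʳ a) (lin-0 ρ)) (identityʳ a)
  lin-unit (Fin.suc i) (a ∷ ρ) = trans (identityˡ _) (lin-unit i ρ)

  pos neg : ∀ {n} → Expr n → Vec ℕ n
  pos (var i) = unit i
  pos :0 = replicate _ 0
  pos (e :+ f) = zipWith ℕ._+_ (pos e) (pos f)
  pos (:- e) = neg e
  neg (var i) = replicate _ 0
  neg :0 = replicate _ 0
  neg (e :+ f) = zipWith ℕ._+_ (neg e) (neg f)
  neg (:- e) = pos e

  ∸-shift : ∀ a b c d → (a + b) + - (c + d) ≡ (a + - c) + (b + - d)
  ∸-shift a b c d = trans (cong ((a + b) +_) (sym (⁻¹-∙-comm c d))) (interchange a b (- c) (- d))

  pos-neg : ∀ {n} (e : Expr n) ρ → lin (pos e) ρ + - lin (neg e) ρ ≡ ⟦ e ⟧ ρ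
  pos-neg (var i) ρ =
    trans (cong₂ _+_ (lin-unit i ρ) (trans (cong -_ (lin-0 ρ)) ε⁻¹≈ε)) (identityʳ _)
  pos-neg :0 ρ = inverseʳ (lin (replicate _ 0) ρ)
  pos-neg (e :+ f) ρ = begin
    lin (zipWith ℕ._+_ (pos e) (pos f)) ρ + - lin (zipWith ℕ._+_ (neg e) (neg f)) ρ
      ≡⟨ cong₂ (λ a b → a + - b) (lin-+ (pos e) (pos f) ρ) (lin-+ (neg e) (neg f) ρ) ⟩
    (lin (pos e) ρ + lin (pos f) ρ) + - (lin (neg e) ρ + lin (neg f) ρ)
      ≡⟨ ∸-shift (lin (pos e) ρ) (lin (pos f) ρ) (lin (neg e) ρ) (lin (neg f) ρ) ⟩
    (lin (pos e) ρ + - lin (neg e) ρ) + (lin (pos f) ρ + - lin (neg f) ρ)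
      ≡⟨ cong₂ _+_ (pos-neg e ρ) (pos-neg f ρ) ⟩
    ⟦ e :+ f ⟧ ρ ∎
  pos-neg (:- e) ρ = begin
    lin (neg e) ρ + - lin (pos e) ρ ≡⟨ cong (_+ - lin (pos e) ρ) (sym (⁻¹-involutive _)) ⟩
    - - lin (neg e) ρ + - lin (pos e) ρ ≡⟨ ⁻¹-∙-comm _ _ ⟩
    - (- lin (neg e) ρ + lin (pos e) ρ) ≡⟨ cong -_ (trans (comm _ _) (pos-neg e ρ)) ⟩
    - ⟦ e ⟧ ρ ∎

  ×′-reduce : ∀ m l a → ((m ∸ l) ×′ a) + - ((l ∸ m) ×′ a) ≡ (m ×′ a) + - (l ×′ a)
  ×′-reduce zero zero a = refl
  ×′-reduce zero (suc l) a = refl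
  ×′-reduce (suc m) zero a = refl
  ×′-reduce (suc m) (suc l) a = trans (×′-reduce m l a) (sym (begin
    (a + (m ×′ a)) + - (a + (l ×′ a)) ≡⟨ ∸-shift a (m ×′ a) a (l ×′ a) ⟩
    (a + - a) + ((m ×′ a) + - (l ×′ a)) ≡⟨ cong (_+ ((m ×′ a) + - (l ×′ a))) (inverseʳ a) ⟩
    0# + ((m ×′ a) + - (l ×′ a)) ≡⟨ identityˡ _ ⟩
    (m ×′ a) + - (l ×′ a) ∎))

  lin-reduce : ∀ {n} (u v : Vec ℕ n) ρ →
    lin (zipWith _∸_ u v) ρ + - lin (zipWith _∸_ v u) ρ ≡ lin u ρ + - lin v ρ
  lin-reduce [] [] [] = refl
  lin-reduce (m ∷ u) (l ∷ v) (a ∷ ρ) = begin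
    _ ≡⟨ ∸-shift ((m ∸ l) ×′ a) _ ((l ∸ m) ×′ a) _ ⟩
    _ ≡⟨ cong₂ _+_ (×′-reduce m l a) (lin-reduce u v ρ) ⟩
    _ ≡⟨ sym (∸-shift (m ×′ a) (lin u ρ) (l ×′ a) (lin v ρ)) ⟩
    _ ∎

  -- Integer coefficients are pairs of naturals. Truncated subtraction in both directions leaves
  -- each coefficient on one side only, so expressions with equal integer coefficients get the same
  -- normal form and `refl` settles the identity.
  ⟦_⇓⟧ : ∀ {n} → Expr n → Vec A n → A
  ⟦ e ⇓⟧ ρ = lin (zipWith _∸_ (pos e) (neg e)) ρ + - lin (zipWith _∸_ (neg e) (pos e)) ρ

  correct : ∀ {n} (e : Expr n) ρ → ⟦ e ⇓⟧ ρ ≡ ⟦ e ⟧ ρ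
  correct e ρ = trans (lin-reduce (pos e) (neg e) ρ) (pos-neg e ρ)

  open Reflection (setoid A) var ⟦_⟧ ⟦_⇓⟧ correct public using (solve; _⊜_)

module AdditiveMap {A B : Set} {_+_ : A → A → A} {0# : A} {neg : A → A} {_+′_ : B → B → B} {0#′ : B} {neg′ : B → B}
  (A-group : IsAbelianGroup _≡_ _+_ 0# neg) (B-group : IsAbelianGroup _≡_ _+′_ 0#′ neg′)
  (f : A → B) (f-+ : ∀ a b → f (a + b) ≡ (f a) +′ (f b)) where

  private
    module A = IsAbelianGroup A-group
    module B = AbelianGroupProperties (abelianGroup B-group)

  f-0 : f 0# ≡ 0#′
  f-0 = B.identityˡ-unique (f 0#) (f 0#) (trans (sym (f-+ 0# 0#)) (cong f (A.identityˡ 0#)))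

  f-neg : ∀ a → f (neg a) ≡ neg′ (f a)
  f-neg a = B.inverseˡ-unique (f (neg a)) (f a) (trans (sym (f-+ (neg a) a)) (trans (cong f (A.inverseˡ a)) f-0))

  f-sub : ∀ a b → f (a + neg b) ≡ (f a) +′ neg′ (f b)
  f-sub a b = trans (f-+ a (neg b)) (cong ((f a) +′_) (f-neg b))

-- The prime field and its coordinate spaces.

module Arithmetic (p : ℕ) (prime : Prime p) .{{nz : NonZero p}} where

  infixl 6 _⊕_ _⊖_ _+ᵥ_ _-ᵥ_
  infixl 7 _⊛_ _·ᵥ_

  𝔽 : Set
  𝔽 = F p

  _⊕_ _⊛_ _⊖_ : 𝔽 → 𝔽 → 𝔽
  _⊕_ = _+F_ p
  _⊛_ = _*F_ p

  0𝔽 1𝔽 : 𝔽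
  0𝔽 = 0F p
  1𝔽 = 1 mod p

  neg𝔽 : 𝔽 → 𝔽
  neg𝔽 a = (p ∸ toℕ a) mod p

  a ⊖ b = a ⊕ neg𝔽 b

  mod-≡ : ∀ {m n} → m % p ≡ n % p → m mod p ≡ n mod p
  mod-≡ {m} {n} eq = toℕ-injective (trans (toℕ-fromℕ< _) (trans eq (sym (toℕ-fromℕ< _))))

  toℕ-mod : ∀ m → toℕ (m mod p) ≡ m % p
  toℕ-mod m = toℕ-fromℕ< _

  mod-toℕ : ∀ a → toℕ a mod p ≡ a
  mod-toℕ a = toℕ-injective (trans (toℕ-mod (toℕ a)) (m<n⇒m%n≡m (toℕ<n a)))

  mod-+ : ∀ m n → (m mod p) ⊕ (n mod p) ≡ (m ℕ.+ n) mod p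
  mod-+ m n = mod-≡ (trans (cong (_% p) (cong₂ ℕ._+_ (toℕ-mod m) (toℕ-mod n))) (sym (%-distribˡ-+ m n p)))

  mod-* : ∀ m n → (m mod p) ⊛ (n mod p) ≡ (m ℕ.* n) mod p
  mod-* m n = mod-≡ (trans (cong (_% p) (cong₂ ℕ._*_ (toℕ-mod m) (toℕ-mod n))) (sym (%-distribˡ-* m n p)))

  mod-+ˡ : ∀ m b → (m mod p) ⊕ b ≡ (m ℕ.+ toℕ b) mod p
  mod-+ˡ m b = trans (cong ((m mod p) ⊕_) (sym (mod-toℕ b))) (mod-+ m (toℕ b))

  mod-+ʳ : ∀ a n → a ⊕ (n mod p) ≡ (toℕ a ℕ.+ n) mod p
  mod-+ʳ a n = trans (cong (_⊕ (n mod p)) (sym (mod-toℕ a))) (mod-+ (toℕ a) n)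

  mod-*ˡ : ∀ m b → (m mod p) ⊛ b ≡ (m ℕ.* toℕ b) mod p
  mod-*ˡ m b = trans (cong ((m mod p) ⊛_) (sym (mod-toℕ b))) (mod-* m (toℕ b))

  mod-*ʳ : ∀ a n → a ⊛ (n mod p) ≡ (toℕ a ℕ.* n) mod p
  mod-*ʳ a n = trans (cong (_⊛ (n mod p)) (sym (mod-toℕ a))) (mod-* (toℕ a) n)

  p-mod : p mod p ≡ 0𝔽
  p-mod = mod-≡ (trans (n%n≡0 p) (sym (m<n⇒m%n≡m (ℕ.>-nonZero⁻¹ p))))

  ⊕-assoc : ∀ a b c → (a ⊕ b) ⊕ c ≡ a ⊕ (b ⊕ c)
  ⊕-assoc a b c = trans (mod-+ˡ _ c) (trans (cong (_mod p) (ℕₚ.+-assoc (toℕ a) _ _)) (sym (mod-+ʳ a _)))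

  ⊕-comm : ∀ a b → a ⊕ b ≡ b ⊕ a
  ⊕-comm a b = cong (_mod p) (ℕₚ.+-comm (toℕ a) (toℕ b))

  ⊕-identityˡ : ∀ a → 0𝔽 ⊕ a ≡ a
  ⊕-identityˡ a = trans (mod-+ˡ 0 a) (mod-toℕ a)

  ⊕-identityʳ : ∀ a → a ⊕ 0𝔽 ≡ a
  ⊕-identityʳ a = trans (⊕-comm a 0𝔽) (⊕-identityˡ a)

  ⊕-inverseʳ : ∀ a → a ⊖ a ≡ 0𝔽
  ⊕-inverseʳ a =
    trans (mod-+ʳ a _) (trans (cong (_mod p) (ℕₚ.m+[n∸m]≡n (ℕₚ.<⇒≤ (toℕ<n a)))) p-mod)

  ⊕-inverseˡ : ∀ a → neg𝔽 a ⊕ a ≡ 0𝔽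
  ⊕-inverseˡ a = trans (⊕-comm _ a) (⊕-inverseʳ a)

  ⊕-isAbelianGroup : IsAbelianGroup _≡_ _⊕_ 0𝔽 neg𝔽
  ⊕-isAbelianGroup = record
    { isGroup = record
      { isMonoid = record
        { isSemigroup = record { isMagma = isMagma _⊕_ ; assoc = ⊕-assoc }
        ; identity = ⊕-identityˡ , ⊕-identityʳ }
      ; inverse = ⊕-inverseˡ , ⊕-inverseʳ
      ; ⁻¹-cong = cong neg𝔽 }
    ; comm = ⊕-comm }

  ⊛-assoc : ∀ a b c → (a ⊛ b) ⊛ c ≡ a ⊛ (b ⊛ c)
  ⊛-assoc a b c = trans (mod-*ˡ _ c) (trans (cong (_mod p) (ℕₚ.*-assoc (toℕ a) _ _)) (sym (mod-*ʳ a _)))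

  ⊛-comm : ∀ a b → a ⊛ b ≡ b ⊛ a
  ⊛-comm a b = cong (_mod p) (ℕₚ.*-comm (toℕ a) (toℕ b))

  ⊛-identityˡ : ∀ a → 1𝔽 ⊛ a ≡ a
  ⊛-identityˡ a = trans (mod-*ˡ 1 a) (trans (cong (_mod p) (ℕₚ.*-identityˡ (toℕ a))) (mod-toℕ a))

  ⊛-zeroˡ : ∀ a → 0𝔽 ⊛ a ≡ 0𝔽
  ⊛-zeroˡ a = mod-*ˡ 0 a

  ⊛-distribʳ : ∀ a b c → (b ⊕ c) ⊛ a ≡ b ⊛ a ⊕ c ⊛ a
  ⊛-distribʳ a b c =
    trans (mod-*ˡ (toℕ b ℕ.+ toℕ c) a) (trans (cong (_mod p) (ℕₚ.*-distribʳ-+ (toℕ a) (toℕ b) (toℕ c))) (sym (mod-+ (toℕ b ℕ.* toℕ a) (toℕ c ℕ.* toℕ a))))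

  commutativeSemiring : CommutativeSemiring _ _
  commutativeSemiring = record
    { isCommutativeSemiring = isCommutativeSemiringˡ (record
      { +-isCommutativeMonoid = IsAbelianGroup.isCommutativeMonoid ⊕-isAbelianGroup
      ; *-isCommutativeMonoid = record
        { isMonoid = record
          { isSemigroup = record { isMagma = isMagma _⊛_ ; assoc = ⊛-assoc }
          ; identity = ⊛-identityˡ , λ a → trans (⊛-comm a 1𝔽) (⊛-identityˡ a) }
        ; comm = ⊛-comm }
      ; distribʳ = ⊛-distribʳ ; zeroˡ = ⊛-zeroˡ }) }
    where open import Algebra.Structures.Biased (_≡_ {A = 𝔽}) using (isCommutativeSemiringˡ)

  open CommutativeSemiring commutativeSemiring public
    using () renaming (zeroʳ to ⊛-zeroʳ; distribˡ to ⊛-distribˡ; *-identityʳ to ⊛-identityʳ)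

  module 𝔽-Solver = NaturalCoefficients commutativeSemiring
  module ⊕-Solver = AbelianGroupSolver ⊕-isAbelianGroup
  module 𝔽ₚ = AbelianGroupProperties (abelianGroup ⊕-isAbelianGroup)

  1𝔽≢0𝔽 : 1𝔽 ≢ 0𝔽
  1𝔽≢0𝔽 eq = contradiction (trans (sym (m<n⇒m%n≡m 1<p)) (trans (sym (toℕ-mod 1)) (trans (cong toℕ eq) (trans (toℕ-mod 0) (m<n⇒m%n≡m (ℕ.>-nonZero⁻¹ p)))))) λ ()
    where 1<p = ℕ.nonTrivial⇒n>1 p {{prime⇒nonTrivial prime}}

  ⊛-inverse-Bézout : ∀ a → Bézout.Identity.Identity 1 p (toℕ a) → ∃ λ b → b ⊛ a ≡ 1𝔽
  ⊛-inverse-Bézout a (Bézout.-+ x y h) = y mod p , (begin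
    (y mod p) ⊛ a ≡⟨ mod-*ˡ y a ⟩
    (y ℕ.* toℕ a) mod p ≡⟨ cong (_mod p) (sym h) ⟩
    (1 ℕ.+ x ℕ.* p) mod p ≡⟨ sym (trans (cong (1𝔽 ⊕_) (mod-* x p)) (mod-+ 1 _)) ⟩
    1𝔽 ⊕ (x mod p) ⊛ (p mod p) ≡⟨ cong (λ z → 1𝔽 ⊕ (x mod p) ⊛ z) p-mod ⟩
    1𝔽 ⊕ (x mod p) ⊛ 0𝔽 ≡⟨ trans (cong (1𝔽 ⊕_) (⊛-zeroʳ (x mod p))) (⊕-identityʳ 1𝔽) ⟩
    1𝔽 ∎)
  -- Here the identity reads 1 + y a = x p, so y represents minus an inverse.
  ⊛-inverse-Bézout a (Bézout.+- x y h) = neg𝔽 Y , (begin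
    neg𝔽 Y ⊛ a ≡⟨ sym (trans (cong (_⊕ neg𝔽 Y ⊛ a) 1+Ya) (⊕-identityˡ _)) ⟩
    (1𝔽 ⊕ Y ⊛ a) ⊕ neg𝔽 Y ⊛ a ≡⟨ ⊕-assoc 1𝔽 _ _ ⟩
    1𝔽 ⊕ (Y ⊛ a ⊕ neg𝔽 Y ⊛ a) ≡⟨ cong (1𝔽 ⊕_) (trans (sym (⊛-distribʳ a Y (neg𝔽 Y))) (trans (cong (_⊛ a) (⊕-inverseʳ Y)) (⊛-zeroˡ a))) ⟩
    1𝔽 ⊕ 0𝔽 ≡⟨ ⊕-identityʳ 1𝔽 ⟩
    1𝔽 ∎)
    where
      Y = y mod p
      1+Ya : 1𝔽 ⊕ Y ⊛ a ≡ 0𝔽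
      1+Ya = begin
        1𝔽 ⊕ Y ⊛ a ≡⟨ cong (1𝔽 ⊕_) (mod-*ˡ y a) ⟩
        1𝔽 ⊕ ((y ℕ.* toℕ a) mod p) ≡⟨ mod-+ 1 _ ⟩
        (1 ℕ.+ y ℕ.* toℕ a) mod p ≡⟨ cong (_mod p) h ⟩
        (x ℕ.* p) mod p ≡⟨ sym (mod-* x p) ⟩
        (x mod p) ⊛ (p mod p) ≡⟨ trans (cong ((x mod p) ⊛_) p-mod) (⊛-zeroʳ (x mod p)) ⟩
        0𝔽 ∎

  ⊛-inverse : ∀ a → a ≢ 0𝔽 → ∃ λ b → b ⊛ a ≡ 1𝔽
  ⊛-inverse a a≢0 = ⊛-inverse-Bézout a (coprime-Bézout (prime⇒coprime prime {{toℕa≢0}} (toℕ<n a)))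
    where
      toℕa≢0 : NonZero (toℕ a)
      toℕa≢0 = ℕ.≢-nonZero (λ eq → a≢0 (trans (sym (mod-toℕ a)) (cong (_mod p) eq)))

  _+ᵥ_ _-ᵥ_ : ∀ {n} → G p n → G p n → G p n
  _+ᵥ_ = _+G_ p

  negᵥ : ∀ {n} → G p n → G p n
  negᵥ = map neg𝔽

  u -ᵥ v = u +ᵥ negᵥ v

  0ᵥ : ∀ {n} → G p n
  0ᵥ = 0G p _

  _·ᵥ_ : ∀ {n} → 𝔽 → G p n → G p n
  _·ᵥ_ = _·G_ p

  +ᵥ-isAbelianGroup : ∀ {n} → IsAbelianGroup _≡_ (_+ᵥ_ {n}) 0ᵥ negᵥ
  +ᵥ-isAbelianGroup = record
    { isGroup = record
      { isMonoid = record
        { isSemigroup = record { isMagma = isMagma _+ᵥ_ ; assoc = zipWith-assoc ⊕-assoc }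
        ; identity = zipWith-identityˡ ⊕-identityˡ , zipWith-identityʳ ⊕-identityʳ }
      ; inverse = zipWith-inverseˡ ⊕-inverseˡ , zipWith-inverseʳ ⊕-inverseʳ
      ; ⁻¹-cong = cong negᵥ }
    ; comm = zipWith-comm ⊕-comm }

  module +ᵥ-Solver {n} = AbelianGroupSolver (+ᵥ-isAbelianGroup {n})
  module 𝔾ₚ {n} = AbelianGroupProperties (abelianGroup (+ᵥ-isAbelianGroup {n}))

-- Linear algebra over the prime field.

module LinearAlgebra (p : ℕ) (prime : Prime p) .{{nz : NonZero p}} where

  open Arithmetic p prime public

  infixl 7 _∙_

  _∙_ : ∀ {n} → G p n → G p n → 𝔽
  _∙_ = dot p

  lc : ∀ {r n} → Vec 𝔽 r → Vec (G p n) r → G p n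
  lc = lincomb p

  ap : ∀ {m n} → Mat p m n → G p n → G p m
  ap = apply p

  ∙-comm : ∀ {n} (x y : G p n) → x ∙ y ≡ y ∙ x
  ∙-comm [] [] = refl
  ∙-comm (a ∷ x) (b ∷ y) = cong₂ _⊕_ (⊛-comm a b) (∙-comm x y)

  ∙-+ˡ : ∀ {n} (x y z : G p n) → (x +ᵥ y) ∙ z ≡ x ∙ z ⊕ y ∙ z
  ∙-+ˡ [] [] [] = sym (⊕-identityˡ 0𝔽)
  ∙-+ˡ (a ∷ x) (b ∷ y) (c ∷ z) = trans (cong ((a ⊕ b) ⊛ c ⊕_) (∙-+ˡ x y z))
    (solve 5 (λ a b c s t → (a :+ b) :* c :+ (s :+ t) := a :* c :+ s :+ (b :* c :+ t)) refl a b c (x ∙ z) (y ∙ z))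
    where open 𝔽-Solver

  ∙-·ˡ : ∀ {n} c (x z : G p n) → (c ·ᵥ x) ∙ z ≡ c ⊛ (x ∙ z)
  ∙-·ˡ c [] [] = sym (⊛-zeroʳ c)
  ∙-·ˡ c (a ∷ x) (b ∷ z) = trans (cong₂ _⊕_ (⊛-assoc c a b) (∙-·ˡ c x z)) (sym (⊛-distribˡ c (a ⊛ b) (x ∙ z)))

  ∙-0ˡ : ∀ {n} (z : G p n) → 0ᵥ ∙ z ≡ 0𝔽
  ∙-0ˡ [] = refl
  ∙-0ˡ (b ∷ z) = trans (cong₂ _⊕_ (⊛-zeroˡ b) (∙-0ˡ z)) (⊕-identityˡ 0𝔽)

  ∙-0ʳ : ∀ {n} (z : G p n) → z ∙ 0ᵥ ≡ 0𝔽
  ∙-0ʳ z = trans (∙-comm z 0ᵥ) (∙-0ˡ z)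

  ∙-+ʳ : ∀ {n} (z x y : G p n) → z ∙ (x +ᵥ y) ≡ z ∙ x ⊕ z ∙ y
  ∙-+ʳ z x y = trans (∙-comm z (x +ᵥ y)) (trans (∙-+ˡ x y z) (cong₂ _⊕_ (∙-comm x z) (∙-comm y z)))

  ∙-·ʳ : ∀ {n} c (z x : G p n) → z ∙ (c ·ᵥ x) ≡ c ⊛ (z ∙ x)
  ∙-·ʳ c z x = trans (∙-comm z (c ·ᵥ x)) (trans (∙-·ˡ c x z) (cong (c ⊛_) (∙-comm x z)))

  module ∙-left {n} (z : G p n) = AdditiveMap +ᵥ-isAbelianGroup ⊕-isAbelianGroup (_∙ z) (λ x y → ∙-+ˡ x y z)
  module ∙-right {n} (z : G p n) = AdditiveMap +ᵥ-isAbelianGroup ⊕-isAbelianGroup (z ∙_) (∙-+ʳ z)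

  ∙-ext : ∀ {n} {u v : G p n} → (∀ x → u ∙ x ≡ v ∙ x) → u ≡ v
  ∙-ext {u = []} {[]} h = refl
  ∙-ext {u = a ∷ u} {b ∷ v} h = cong₂ _∷_
    (trans (sym (e₀ a u)) (trans (h (1𝔽 ∷ 0ᵥ)) (e₀ b v)))
    (∙-ext (λ x → trans (sym (below a u x)) (trans (h (0𝔽 ∷ x)) (below b v x))))
    where
      e₀ : ∀ a u → (a ∷ u) ∙ (1𝔽 ∷ 0ᵥ) ≡ a
      e₀ a u = trans (cong₂ _⊕_ (⊛-identityʳ a) (∙-0ʳ u)) (⊕-identityʳ a)
      below : ∀ a u x → (a ∷ u) ∙ (0𝔽 ∷ x) ≡ u ∙ x
      below a u x = trans (cong (_⊕ u ∙ x) (⊛-zeroʳ a)) (⊕-identityˡ _)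

  ap-+ : ∀ {m n} (T : Mat p m n) x y → ap T (x +ᵥ y) ≡ ap T x +ᵥ ap T y
  ap-+ [] x y = refl
  ap-+ (r ∷ T) x y = cong₂ _∷_ (∙-+ʳ r x y) (ap-+ T x y)

  ap-· : ∀ {m n} (T : Mat p m n) c x → ap T (c ·ᵥ x) ≡ c ·ᵥ ap T x
  ap-· [] c x = refl
  ap-· (r ∷ T) c x = cong₂ _∷_ (∙-·ʳ c r x) (ap-· T c x)

  module ap-additive {m n} (T : Mat p m n) = AdditiveMap +ᵥ-isAbelianGroup +ᵥ-isAbelianGroup (ap T) (ap-+ T)

  -- With `vs` read as the rows of a matrix, `ap vs` is the matrix and `lc` its transpose, so this
  -- is their adjunction. Together with `∙-ext` it reduces identities about `lc` to identities about
  -- `ap`.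
  lc-∙ : ∀ {r n} (c : Vec 𝔽 r) (vs : Vec (G p n) r) x → lc c vs ∙ x ≡ c ∙ ap vs x
  lc-∙ [] [] x = ∙-0ˡ x
  lc-∙ (a ∷ c) (v ∷ vs) x = trans (∙-+ˡ (a ·ᵥ v) (lc c vs) x) (cong₂ _⊕_ (∙-·ˡ a v x) (lc-∙ c vs x))

  ap-zipWith : ∀ {m n} (S T : Mat p m n) x → ap (zipWith _+ᵥ_ S T) x ≡ ap S x +ᵥ ap T x
  ap-zipWith [] [] x = refl
  ap-zipWith (r ∷ S) (s ∷ T) x = cong₂ _∷_ (∙-+ˡ r s x) (ap-zipWith S T x)

  lc-+ˡ : ∀ {r n} (c d : Vec 𝔽 r) (vs : Vec (G p n) r) → lc (c +ᵥ d) vs ≡ lc c vs +ᵥ lc d vs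
  lc-+ˡ c d vs = ∙-ext λ x → begin
    lc (c +ᵥ d) vs ∙ x ≡⟨ lc-∙ (c +ᵥ d) vs x ⟩
    (c +ᵥ d) ∙ ap vs x ≡⟨ ∙-+ˡ c d (ap vs x) ⟩
    c ∙ ap vs x ⊕ d ∙ ap vs x ≡⟨ sym (cong₂ _⊕_ (lc-∙ c vs x) (lc-∙ d vs x)) ⟩
    lc c vs ∙ x ⊕ lc d vs ∙ x ≡⟨ sym (∙-+ˡ (lc c vs) (lc d vs) x) ⟩
    (lc c vs +ᵥ lc d vs) ∙ x ∎

  lc-+ʳ : ∀ {r n} (c : Vec 𝔽 r) (vs ws : Vec (G p n) r) → lc c (zipWith _+ᵥ_ vs ws) ≡ lc c vs +ᵥ lc c ws
  lc-+ʳ c vs ws = ∙-ext λ x → begin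
    lc c (zipWith _+ᵥ_ vs ws) ∙ x ≡⟨ lc-∙ c (zipWith _+ᵥ_ vs ws) x ⟩
    c ∙ ap (zipWith _+ᵥ_ vs ws) x ≡⟨ cong (c ∙_) (ap-zipWith vs ws x) ⟩
    c ∙ (ap vs x +ᵥ ap ws x) ≡⟨ ∙-+ʳ c (ap vs x) (ap ws x) ⟩
    c ∙ ap vs x ⊕ c ∙ ap ws x ≡⟨ sym (cong₂ _⊕_ (lc-∙ c vs x) (lc-∙ c ws x)) ⟩
    lc c vs ∙ x ⊕ lc c ws ∙ x ≡⟨ sym (∙-+ˡ (lc c vs) (lc c ws) x) ⟩
    (lc c vs +ᵥ lc c ws) ∙ x ∎

  module lc-left {r n} (vs : Vec (G p n) r) =
    AdditiveMap +ᵥ-isAbelianGroup +ᵥ-isAbelianGroup (λ c → lc c vs) (λ c d → lc-+ˡ c d vs)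

  lc-++ : ∀ {r s n} (c : Vec 𝔽 r) (d : Vec 𝔽 s) (vs : Vec (G p n) r) ws →
    lc (c ++ d) (vs ++ ws) ≡ lc c vs +ᵥ lc d ws
  lc-++ [] d [] ws = sym (IsAbelianGroup.identityˡ +ᵥ-isAbelianGroup (lc d ws))
  lc-++ (a ∷ c) d (v ∷ vs) ws =
    trans (cong (a ·ᵥ v +ᵥ_) (lc-++ c d vs ws)) (sym (IsAbelianGroup.assoc +ᵥ-isAbelianGroup (a ·ᵥ v) (lc c vs) (lc d ws)))

  tail-lc : ∀ {r n} (c : Vec 𝔽 r) (vs : Vec (G p (suc n)) r) → tail (lc c vs) ≡ lc c (map tail vs)
  tail-lc [] [] = refl
  tail-lc (a ∷ c) ((b ∷ v) ∷ vs) = trans (tail-+ (a ·ᵥ (b ∷ v)) (lc c vs)) (cong (a ·ᵥ v +ᵥ_) (tail-lc c vs))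
    where
      tail-+ : ∀ {n} (u w : G p (suc n)) → tail (u +ᵥ w) ≡ tail u +ᵥ tail w
      tail-+ (_ ∷ _) (_ ∷ _) = refl

  module _ (f : 𝔽 → 𝔽) (f-+ : ∀ a b → f (a ⊕ b) ≡ f a ⊕ f b) where

    private module f = AdditiveMap ⊕-isAbelianGroup ⊕-isAbelianGroup f f-+

    -- Every scalar of a prime field is a sum of ones, so additivity already forces homogeneity.
    -- Hence additivity is all that has to be checked of the glued map.
    additive-mod : ∀ m → f (m mod p) ≡ f 1𝔽 ⊛ (m mod p)
    additive-mod zero = trans f.f-0 (sym (⊛-zeroʳ (f 1𝔽)))
    additive-mod (suc m) = begin
      f (suc m mod p) ≡⟨ cong f (sym (mod-+ 1 m)) ⟩
      f (1𝔽 ⊕ m mod p) ≡⟨ f-+ 1𝔽 (m mod p) ⟩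
      f 1𝔽 ⊕ f (m mod p) ≡⟨ cong₂ _⊕_ (sym (⊛-identityʳ (f 1𝔽))) (additive-mod m) ⟩
      f 1𝔽 ⊛ 1𝔽 ⊕ f 1𝔽 ⊛ (m mod p) ≡⟨ sym (⊛-distribˡ (f 1𝔽) 1𝔽 (m mod p)) ⟩
      f 1𝔽 ⊛ (1𝔽 ⊕ m mod p) ≡⟨ cong (f 1𝔽 ⊛_) (mod-+ 1 m) ⟩
      f 1𝔽 ⊛ (suc m mod p) ∎

  additive⇒linear : ∀ {n} (f : G p n → 𝔽) → (∀ x y → f (x +ᵥ y) ≡ f x ⊕ f y) → ∃ λ a → ∀ x → f x ≡ a ∙ x
  additive⇒linear {zero} f f-+ = [] , λ { [] → AdditiveMap.f-0 +ᵥ-isAbelianGroup ⊕-isAbelianGroup f f-+ }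
  additive⇒linear {suc n} f f-+ = f (1𝔽 ∷ 0ᵥ) ∷ proj₁ rest , λ { (a ∷ x) → begin
    f (a ∷ x) ≡⟨ cong f (cong₂ _∷_ (sym (⊕-identityʳ a)) (sym (idˡ x))) ⟩
    f ((a ∷ 0ᵥ) +ᵥ (0𝔽 ∷ x)) ≡⟨ f-+ (a ∷ 0ᵥ) (0𝔽 ∷ x) ⟩
    f (a ∷ 0ᵥ) ⊕ f (0𝔽 ∷ x) ≡⟨ cong₂ _⊕_ (first a) (proj₂ rest x) ⟩
    f (1𝔽 ∷ 0ᵥ) ⊛ a ⊕ proj₁ rest ∙ x ∎ }
    where
      idˡ : ∀ {n} (x : G p n) → 0ᵥ +ᵥ x ≡ x
      idˡ = IsAbelianGroup.identityˡ +ᵥ-isAbelianGroup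
      rest = additive⇒linear (λ x → f (0𝔽 ∷ x)) (λ x y →
        trans (cong (λ a → f (a ∷ (x +ᵥ y))) (sym (⊕-identityʳ 0𝔽))) (f-+ (0𝔽 ∷ x) (0𝔽 ∷ y)))
      first : ∀ a → f (a ∷ 0ᵥ) ≡ f (1𝔽 ∷ 0ᵥ) ⊛ a
      first a = begin
        f (a ∷ 0ᵥ) ≡⟨ cong (λ a → f (a ∷ 0ᵥ)) (sym (mod-toℕ a)) ⟩
        f ((toℕ a mod p) ∷ 0ᵥ) ≡⟨ additive-mod (λ a → f (a ∷ 0ᵥ)) (λ a b →
          trans (cong (λ x → f ((a ⊕ b) ∷ x)) (sym (idˡ 0ᵥ))) (f-+ (a ∷ 0ᵥ) (b ∷ 0ᵥ))) (toℕ a) ⟩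
        f (1𝔽 ∷ 0ᵥ) ⊛ (toℕ a mod p) ≡⟨ cong (f (1𝔽 ∷ 0ᵥ) ⊛_) (mod-toℕ a) ⟩
        f (1𝔽 ∷ 0ᵥ) ⊛ a ∎

  search-Fin : ∀ {m} {P Q : Fin m → Set} → (∀ i → P i ⊎ Q i) → ∃ P ⊎ (∀ i → Q i)
  search-Fin {zero} d = inj₂ λ ()
  search-Fin {suc m} d with d Fin.zero | search-Fin (d ∘ Fin.suc)
  ... | inj₁ h | _ = inj₁ (Fin.zero , h)
  ... | inj₂ _ | inj₁ (i , h) = inj₁ (Fin.suc i , h)
  ... | inj₂ h | inj₂ g = inj₂ λ { Fin.zero → h ; (Fin.suc i) → g i }

  -- Exhaustive search over a finite space stands in for excluded middle in the arguments by
  -- contradiction.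
  search : ∀ {n} {P Q : G p n → Set} → (∀ x → P x ⊎ Q x) → ∃ P ⊎ (∀ x → Q x)
  search {zero} d with d []
  ... | inj₁ h = inj₁ ([] , h)
  ... | inj₂ h = inj₂ λ { [] → h }
  search {suc n} d with search-Fin (λ a → search (λ x → d (a ∷ x)))
  ... | inj₁ (a , x , h) = inj₁ (a ∷ x , h)
  ... | inj₂ h = inj₂ λ { (a ∷ x) → h a x }

  _≟ᵥ_ : ∀ {n} (x y : G p n) → x ≡ y ⊎ x ≢ y
  x ≟ᵥ y with ≡-dec Fin._≟_ x y
  ... | yes h = inj₁ h
  ... | no h = inj₂ h

  private
    encode : ∀ {n} → G p n → Fin (p ℕ.^ n)
    encode [] = Fin.zero
    encode (a ∷ x) = Fin.combine a (encode x)

    decode : ∀ {n} → Fin (p ℕ.^ n) → G p n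
    decode {zero} i = []
    decode {suc n} i = proj₁ (Fin.remQuot {p} (p ℕ.^ n) i) ∷ decode (proj₂ (Fin.remQuot {p} (p ℕ.^ n) i))

    encode-injective : ∀ {n} (x y : G p n) → encode x ≡ encode y → x ≡ y
    encode-injective [] [] eq = refl
    encode-injective (a ∷ x) (b ∷ y) eq with combine-injective a (encode x) b (encode y) eq
    ... | a≡b , eq′ = cong₂ _∷_ a≡b (encode-injective x y eq′)

    encode-decode : ∀ {n} (i : Fin (p ℕ.^ n)) → encode (decode {n} i) ≡ i
    encode-decode {zero} Fin.zero = refl
    encode-decode {suc n} i = trans
      (cong (Fin.combine {p} (proj₁ (Fin.remQuot {p} (p ℕ.^ n) i))) (encode-decode {n} (proj₂ (Fin.remQuot {p} (p ℕ.^ n) i))))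
      (combine-remQuot {p} (p ℕ.^ n) i)

  -- Only the cardinalities p^m and p^n are compared, so `f` may be any map, in particular one built
  -- from the results of a search.
  injection⇒≤ : ∀ {m n} (f : G p m → G p n) → (∀ x y → f x ≡ f y → x ≡ y) → m ℕ.≤ n
  injection⇒≤ {m} {n} f f-inj = ℕₚ.≮⇒≥ λ n<m →
    ℕₚ.<⇒≱ (ℕₚ.^-monoʳ-< p (ℕ.nonTrivial⇒n>1 p {{prime⇒nonTrivial prime}}) n<m) (injective⇒≤ {f = g} λ {i} {j} → g-inj i j)
    where
      g : Fin (p ℕ.^ m) → Fin (p ℕ.^ n)
      g i = encode (f (decode {m} i))
      g-inj : ∀ i j → g i ≡ g j → i ≡ j
      g-inj i j eq = trans (sym (encode-decode {m} i)) (trans (cong encode (f-inj _ _ (encode-injective _ _ eq))) (encode-decode {m} j))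

  module 𝔾 {n} = IsAbelianGroup (+ᵥ-isAbelianGroup {n})

  ·-zero : ∀ {n} (v : G p n) → 0𝔽 ·ᵥ v ≡ 0ᵥ
  ·-zero [] = refl
  ·-zero (a ∷ v) = cong₂ _∷_ (⊛-zeroˡ a) (·-zero v)

  ·-+ʳ : ∀ {n} c (u v : G p n) → c ·ᵥ (u +ᵥ v) ≡ c ·ᵥ u +ᵥ c ·ᵥ v
  ·-+ʳ c [] [] = refl
  ·-+ʳ c (a ∷ u) (b ∷ v) = cong₂ _∷_ (⊛-distribˡ c a b) (·-+ʳ c u v)

  ·-+ˡ : ∀ {n} a b (v : G p n) → (a ⊕ b) ·ᵥ v ≡ a ·ᵥ v +ᵥ b ·ᵥ v
  ·-+ˡ a b [] = refl
  ·-+ˡ a b (c ∷ v) = cong₂ _∷_ (⊛-distribʳ c a b) (·-+ˡ a b v)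

  ·-assoc : ∀ {n} a b (v : G p n) → (a ⊛ b) ·ᵥ v ≡ a ·ᵥ (b ·ᵥ v)
  ·-assoc a b [] = refl
  ·-assoc a b (c ∷ v) = cong₂ _∷_ (⊛-assoc a b c) (·-assoc a b v)

  module ·-right {n} c = AdditiveMap (+ᵥ-isAbelianGroup {n}) +ᵥ-isAbelianGroup (c ·ᵥ_) (·-+ʳ c)

  lc-map : ∀ {r m n} (f : G p m → G p n) → (∀ u v → f (u +ᵥ v) ≡ f u +ᵥ f v) → (∀ c v → f (c ·ᵥ v) ≡ c ·ᵥ f v) →
    ∀ (c : Vec 𝔽 r) vs → lc c (map f vs) ≡ f (lc c vs)
  lc-map f f-+ f-· [] [] = sym (AdditiveMap.f-0 +ᵥ-isAbelianGroup +ᵥ-isAbelianGroup f f-+)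
  lc-map f f-+ f-· (a ∷ c) (v ∷ vs) =
    trans (cong₂ _+ᵥ_ (sym (f-· a v)) (lc-map f f-+ f-· c vs)) (sym (f-+ (a ·ᵥ v) (lc c vs)))

  LinIndep-tail : ∀ {r n} {v : G p n} {vs : Vec (G p n) r} → LinIndep p (v ∷ vs) → LinIndep p vs
  LinIndep-tail {v = v} {vs} indep c h =
    proj₂ (∷-injective (indep (0𝔽 ∷ c) (trans (cong₂ _+ᵥ_ (·-zero v) h) (𝔾.identityˡ 0ᵥ))))

  -- Builds a family dual to the independent functionals. Subtracting `lc (ap vs x) ws` from x
  -- projects onto the common kernel of `vs`. If v vanished on that kernel, v would be the
  -- combination of `vs` with coefficients `ap ws v`, against independence. Otherwise a kernel
  -- vector not killed by v is rescaled to `w₀`, and multiples of `w₀` are subtracted from `ws` to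
  -- make v vanish on them.
  right-inverse : ∀ {r n} (vs : Vec (G p n) r) → LinIndep p vs →
    ∃ λ (ws : Vec (G p n) r) → ∀ s → ap vs (lc s ws) ≡ s
  right-inverse [] indep = [] , λ { [] → refl }
  right-inverse {suc r} {n} (v ∷ vs) indep with right-inverse vs (LinIndep-tail indep)
  ... | ws , ws-inv with search {P = λ x → v ∙ (x -ᵥ lc (ap vs x) ws) ≢ 0𝔽} {Q = λ x → v ∙ (x -ᵥ lc (ap vs x) ws) ≡ 0𝔽}
                      (λ x → decide (v ∙ (x -ᵥ lc (ap vs x) ws)))
    where
      decide : ∀ a → a ≢ 0𝔽 ⊎ a ≡ 0𝔽
      decide a with a Fin.≟ 0𝔽
      ... | yes h = inj₂ h
      ... | no h = inj₁ h
  ... | inj₂ zeros = contradiction (proj₁ (∷-injective (indep (neg𝔽 1𝔽 ∷ ap ws v) (∙-ext dependent))))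
          (λ h → 1𝔽≢0𝔽 (trans (sym (𝔽ₚ.⁻¹-involutive 1𝔽)) (trans (cong neg𝔽 h) 𝔽ₚ.ε⁻¹≈ε)))
    where
      dependent : ∀ x → lc (neg𝔽 1𝔽 ∷ ap ws v) (v ∷ vs) ∙ x ≡ 0ᵥ ∙ x
      dependent x = begin
        lc (neg𝔽 1𝔽 ∷ ap ws v) (v ∷ vs) ∙ x ≡⟨ lc-∙ (neg𝔽 1𝔽 ∷ ap ws v) (v ∷ vs) x ⟩
        neg𝔽 1𝔽 ⊛ (v ∙ x) ⊕ ap ws v ∙ ap vs x ≡⟨ cong₂ _⊕_ (trans (neg-⊛ 1𝔽 (v ∙ x)) (cong neg𝔽 (⊛-identityˡ (v ∙ x)))) via-ws ⟩
        neg𝔽 (v ∙ x) ⊕ v ∙ x ≡⟨ ⊕-inverseˡ (v ∙ x) ⟩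
        0𝔽 ≡⟨ sym (∙-0ˡ x) ⟩
        0ᵥ ∙ x ∎
        where
          neg-⊛ : ∀ a b → neg𝔽 a ⊛ b ≡ neg𝔽 (a ⊛ b)
          neg-⊛ a b = AdditiveMap.f-neg ⊕-isAbelianGroup ⊕-isAbelianGroup (_⊛ b) (⊛-distribʳ b) a
          via-ws : ap ws v ∙ ap vs x ≡ v ∙ x
          via-ws = begin
            ap ws v ∙ ap vs x ≡⟨ ∙-comm (ap ws v) (ap vs x) ⟩
            ap vs x ∙ ap ws v ≡⟨ sym (lc-∙ (ap vs x) ws v) ⟩
            lc (ap vs x) ws ∙ v ≡⟨ ∙-comm (lc (ap vs x) ws) v ⟩
            v ∙ lc (ap vs x) ws ≡⟨ sym (𝔽ₚ.x∙y⁻¹≈ε⇒x≈y (v ∙ x) (v ∙ lc (ap vs x) ws) (trans (sym (∙-right.f-sub v x (lc (ap vs x) ws))) (zeros x))) ⟩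
            v ∙ x ∎
  ... | inj₁ (x , vx≢0) = w₀ ∷ ws′ , λ { (a ∷ s) → cong₂ _∷_ (first a s) (rest a s) }
    where
      κ = v ∙ (x -ᵥ lc (ap vs x) ws)
      κ⁻¹ = proj₁ (⊛-inverse κ vx≢0)
      w₀ = κ⁻¹ ·ᵥ (x -ᵥ lc (ap vs x) ws)
      v∙w₀ : v ∙ w₀ ≡ 1𝔽
      v∙w₀ = trans (∙-·ʳ κ⁻¹ v _) (proj₂ (⊛-inverse κ vx≢0))
      vs-w₀ : ∀ a → ap vs (a ·ᵥ w₀) ≡ 0ᵥ
      vs-w₀ a = begin
        ap vs (a ·ᵥ w₀) ≡⟨ trans (ap-· vs a w₀) (cong (a ·ᵥ_) (ap-· vs κ⁻¹ _)) ⟩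
        a ·ᵥ (κ⁻¹ ·ᵥ ap vs (x -ᵥ lc (ap vs x) ws)) ≡⟨ cong (λ z → a ·ᵥ (κ⁻¹ ·ᵥ z)) (begin
          ap vs (x -ᵥ lc (ap vs x) ws) ≡⟨ ap-additive.f-sub vs x (lc (ap vs x) ws) ⟩
          ap vs x -ᵥ ap vs (lc (ap vs x) ws) ≡⟨ cong (ap vs x -ᵥ_) (ws-inv (ap vs x)) ⟩
          ap vs x -ᵥ ap vs x ≡⟨ 𝔾.inverseʳ (ap vs x) ⟩
          0ᵥ ∎) ⟩
        a ·ᵥ (κ⁻¹ ·ᵥ 0ᵥ) ≡⟨ trans (cong (a ·ᵥ_) (·-right.f-0 κ⁻¹)) (·-right.f-0 a) ⟩
        0ᵥ ∎
      correct : G p n → G p n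
      correct w = w -ᵥ (v ∙ w) ·ᵥ w₀
      correct-+ : ∀ u w → correct (u +ᵥ w) ≡ correct u +ᵥ correct w
      correct-+ u w = trans
        (cong (λ z → (u +ᵥ w) -ᵥ z) (trans (cong (_·ᵥ w₀) (∙-+ʳ v u w)) (·-+ˡ (v ∙ u) (v ∙ w) w₀)))
        (solve 4 (λ u w a b → (u :+ w) :- (a :+ b) ⊜ (u :- a) :+ (w :- b)) refl u w ((v ∙ u) ·ᵥ w₀) ((v ∙ w) ·ᵥ w₀))
        where open +ᵥ-Solver
      correct-· : ∀ c w → correct (c ·ᵥ w) ≡ c ·ᵥ correct w
      correct-· c w = trans
        (cong (λ z → c ·ᵥ w -ᵥ z) (trans (cong (_·ᵥ w₀) (∙-·ʳ c v w)) (·-assoc c (v ∙ w) w₀)))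
        (sym (·-right.f-sub c w ((v ∙ w) ·ᵥ w₀)))
      ws′ = map correct ws
      lc-ws′ : ∀ s → lc s ws′ ≡ correct (lc s ws)
      lc-ws′ s = lc-map correct correct-+ correct-· s ws
      v∙scaled : ∀ a → v ∙ (a ·ᵥ w₀) ≡ a
      v∙scaled a = trans (∙-·ʳ a v w₀) (trans (cong (a ⊛_) v∙w₀) (⊛-identityʳ a))
      first : ∀ a s → v ∙ (a ·ᵥ w₀ +ᵥ lc s ws′) ≡ a
      first a s = begin
        v ∙ (a ·ᵥ w₀ +ᵥ lc s ws′) ≡⟨ ∙-+ʳ v (a ·ᵥ w₀) (lc s ws′) ⟩
        v ∙ (a ·ᵥ w₀) ⊕ v ∙ lc s ws′ ≡⟨ cong₂ _⊕_ (v∙scaled a) (begin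
          v ∙ lc s ws′ ≡⟨ cong (v ∙_) (lc-ws′ s) ⟩
          v ∙ correct (lc s ws) ≡⟨ ∙-right.f-sub v (lc s ws) ((v ∙ lc s ws) ·ᵥ w₀) ⟩
          v ∙ lc s ws ⊖ v ∙ ((v ∙ lc s ws) ·ᵥ w₀) ≡⟨ cong (λ z → v ∙ lc s ws ⊖ z) (v∙scaled (v ∙ lc s ws)) ⟩
          v ∙ lc s ws ⊖ v ∙ lc s ws ≡⟨ ⊕-inverseʳ (v ∙ lc s ws) ⟩
          0𝔽 ∎) ⟩
        a ⊕ 0𝔽 ≡⟨ ⊕-identityʳ a ⟩
        a ∎
      rest : ∀ a s → ap vs (a ·ᵥ w₀ +ᵥ lc s ws′) ≡ s
      rest a s = begin
        ap vs (a ·ᵥ w₀ +ᵥ lc s ws′) ≡⟨ ap-+ vs (a ·ᵥ w₀) (lc s ws′) ⟩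
        ap vs (a ·ᵥ w₀) +ᵥ ap vs (lc s ws′) ≡⟨ cong₂ _+ᵥ_ (vs-w₀ a) (trans (cong (ap vs) (lc-ws′ s)) (ap-additive.f-sub vs (lc s ws) ((v ∙ lc s ws) ·ᵥ w₀))) ⟩
        0ᵥ +ᵥ (ap vs (lc s ws) -ᵥ ap vs ((v ∙ lc s ws) ·ᵥ w₀)) ≡⟨ cong₂ (λ a b → 0ᵥ +ᵥ (a -ᵥ b)) (ws-inv s) (vs-w₀ (v ∙ lc s ws)) ⟩
        0ᵥ +ᵥ (s -ᵥ 0ᵥ) ≡⟨ solve 1 (λ s → :0 :+ (s :- :0) ⊜ s) refl s ⟩
        s ∎
        where open +ᵥ-Solver

  -- The map x ↦ x - lc (ap (e ∷ vs) x - (1 ∷ 0)) ws sends everything into the subspace where h vanishes.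
  vanishing⇒lc : ∀ {r n} (e : G p n) (vs : Vec (G p n) r) → LinIndep p (e ∷ vs) → (h : G p n) →
    (∀ x → e ∙ x ≡ 1𝔽 → ap vs x ≡ 0ᵥ → h ∙ x ≡ 0𝔽) → ∃ λ c → h ≡ lc c vs
  vanishing⇒lc {r} {n} e vs indep h vanish = c , ∙-ext h∙x
    where
      ws = proj₁ (right-inverse (e ∷ vs) indep)
      ws-inv = proj₂ (right-inverse (e ∷ vs) indep)
      shift : G p n → Vec 𝔽 (suc r)
      shift x = ap (e ∷ vs) x -ᵥ (1𝔽 ∷ 0ᵥ)
      c₀ = head (ap ws h)
      c = tail (ap ws h)
      shifted : ∀ x → ap (e ∷ vs) (x -ᵥ lc (shift x) ws) ≡ 1𝔽 ∷ 0ᵥ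
      shifted x = begin
        ap (e ∷ vs) (x -ᵥ lc (shift x) ws) ≡⟨ ap-additive.f-sub (e ∷ vs) x (lc (shift x) ws) ⟩
        ap (e ∷ vs) x -ᵥ ap (e ∷ vs) (lc (shift x) ws) ≡⟨ cong (ap (e ∷ vs) x -ᵥ_) (ws-inv (shift x)) ⟩
        ap (e ∷ vs) x -ᵥ shift x ≡⟨ solve 2 (λ a b → a :- (a :- b) ⊜ b) refl (ap (e ∷ vs) x) (1𝔽 ∷ 0ᵥ) ⟩
        1𝔽 ∷ 0ᵥ ∎
        where open +ᵥ-Solver
      h∙x₀ : ∀ x → h ∙ x ≡ (e ∙ x ⊖ 1𝔽) ⊛ c₀ ⊕ c ∙ ap vs x
      h∙x₀ x = begin
        h ∙ x ≡⟨ 𝔽ₚ.x∙y⁻¹≈ε⇒x≈y (h ∙ x) (h ∙ lc (shift x) ws) (trans (sym (∙-right.f-sub h x (lc (shift x) ws)))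
                   (vanish _ (proj₁ (∷-injective (shifted x))) (proj₂ (∷-injective (shifted x))))) ⟩
        h ∙ lc (shift x) ws ≡⟨ trans (∙-comm h (lc (shift x) ws)) (lc-∙ (shift x) ws h) ⟩
        shift x ∙ ap ws h ≡⟨ cong (shift x ∙_) (head∷tail (ap ws h)) ⟩
        (e ∙ x ⊖ 1𝔽) ⊛ c₀ ⊕ (ap vs x -ᵥ 0ᵥ) ∙ c ≡⟨ cong (λ z → (e ∙ x ⊖ 1𝔽) ⊛ c₀ ⊕ z ∙ c) (solve 1 (λ a → a :- :0 ⊜ a) refl (ap vs x)) ⟩
        (e ∙ x ⊖ 1𝔽) ⊛ c₀ ⊕ ap vs x ∙ c ≡⟨ cong ((e ∙ x ⊖ 1𝔽) ⊛ c₀ ⊕_) (∙-comm (ap vs x) c) ⟩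
        (e ∙ x ⊖ 1𝔽) ⊛ c₀ ⊕ c ∙ ap vs x ∎
        where
          open +ᵥ-Solver
          head∷tail : ∀ {n} (x : G p (suc n)) → x ≡ head x ∷ tail x
          head∷tail (_ ∷ _) = refl
      -- At x = 0 the functionals h, e and `vs` all vanish, and the formula for h leaves only minus
      -- `c₀`.
      c₀≡0 : c₀ ≡ 0𝔽
      c₀≡0 = begin
        c₀ ≡⟨ sym (⊛-identityˡ c₀) ⟩
        1𝔽 ⊛ c₀ ≡⟨ sym (𝔽ₚ.⁻¹-involutive (1𝔽 ⊛ c₀)) ⟩
        neg𝔽 (neg𝔽 (1𝔽 ⊛ c₀)) ≡⟨ cong neg𝔽 (sym at-0) ⟩
        neg𝔽 0𝔽 ≡⟨ 𝔽ₚ.ε⁻¹≈ε ⟩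
        0𝔽 ∎
        where
          at-0 : 0𝔽 ≡ neg𝔽 (1𝔽 ⊛ c₀)
          at-0 = begin
            0𝔽 ≡⟨ sym (∙-0ʳ h) ⟩
            h ∙ 0ᵥ ≡⟨ h∙x₀ 0ᵥ ⟩
            (e ∙ 0ᵥ ⊖ 1𝔽) ⊛ c₀ ⊕ c ∙ ap vs 0ᵥ ≡⟨ cong₂ (λ a b → (a ⊖ 1𝔽) ⊛ c₀ ⊕ b) (∙-0ʳ e) (trans (cong (c ∙_) (ap-additive.f-0 vs)) (∙-0ʳ c)) ⟩
            (0𝔽 ⊖ 1𝔽) ⊛ c₀ ⊕ 0𝔽 ≡⟨ trans (⊕-identityʳ _) (cong (_⊛ c₀) (⊕-identityˡ (neg𝔽 1𝔽))) ⟩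
            neg𝔽 1𝔽 ⊛ c₀ ≡⟨ AdditiveMap.f-neg ⊕-isAbelianGroup ⊕-isAbelianGroup (_⊛ c₀) (⊛-distribʳ c₀) 1𝔽 ⟩
            neg𝔽 (1𝔽 ⊛ c₀) ∎
      h∙x : ∀ x → h ∙ x ≡ lc c vs ∙ x
      h∙x x = begin
        h ∙ x ≡⟨ h∙x₀ x ⟩
        (e ∙ x ⊖ 1𝔽) ⊛ c₀ ⊕ c ∙ ap vs x ≡⟨ cong (λ z → (e ∙ x ⊖ 1𝔽) ⊛ z ⊕ c ∙ ap vs x) c₀≡0 ⟩
        (e ∙ x ⊖ 1𝔽) ⊛ 0𝔽 ⊕ c ∙ ap vs x ≡⟨ trans (cong (_⊕ c ∙ ap vs x) (⊛-zeroʳ (e ∙ x ⊖ 1𝔽))) (⊕-identityˡ _) ⟩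
        c ∙ ap vs x ≡⟨ sym (lc-∙ c vs x) ⟩
        lc c vs ∙ x ∎

-- The gluing argument, from an abstract list of properties of the functions involved.

module OverPrimeField (p : ℕ) (prime : Prime p) .{{nz : NonZero p}} where

  open LinearAlgebra p prime

  -- The second variable is written y = o + d with o fixed. O c is the combination of the β_i(·,o) - z_i with
  -- coefficients c, and O c + D c d is that of the β_i(·,o+d) - z_i. Null singles out the constant functions.
  module Extension {k n w : ℕ}
    (D : G p k → G p n → G p w)
    (D-+ˡ : ∀ b c d → D (b +ᵥ c) d ≡ D b d +ᵥ D c d)
    (D-+ʳ : ∀ c d e → D c (d +ᵥ e) ≡ D c d +ᵥ D c e)
    (O : G p k → G p w)
    (O-+ : ∀ b c → O (b +ᵥ c) ≡ O b +ᵥ O c)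
    (Null : G p w → Set)
    (O-independent : ∀ a → Null (O a) → a ≡ 0ᵥ)
    (null-0 : Null 0ᵥ)
    (X : Set)
    (ev : G p w → X → 𝔽)
    (ev-+ : ∀ f g x → ev (f +ᵥ g) x ≡ ev f x ⊕ ev g x)
    (In : X → G p n → Set)
    (In-parallelogram : ∀ {x a b c} → In x a → In x b → In x c → In x (b +ᵥ (c -ᵥ a)))
    (ev-vanishes : ∀ {x d} c → In x d → ev (O c +ᵥ D c d) x ≡ 0𝔽)
    (vanishing₁ : ∀ d h → (∀ a → Null (O a +ᵥ D a d) → a ≡ 0ᵥ) →
      (∀ x → In x d → ev h x ≡ 0𝔽) → ∃ λ a → h ≡ O a +ᵥ D a d)
    (vanishing₃ : ∀ e u v h →
      (∀ a b c → Null ((O a +ᵥ D a e) +ᵥ (D b u +ᵥ D c v)) → a ≡ 0ᵥ × b ≡ 0ᵥ × c ≡ 0ᵥ) →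
      (∀ x → In x e → In x (e +ᵥ u) → In x (e +ᵥ v) → ev h x ≡ 0𝔽) →
      ∃ λ a → ∃ λ b → ∃ λ c → h ≡ (O a +ᵥ D a e) +ᵥ (D b u +ᵥ D c v))
    where

    ΣD : ∀ {m} → Vec (G p k) m → Vec (G p n) m → G p w
    ΣD [] [] = 0ᵥ
    ΣD (c ∷ cs) (d ∷ ds) = D c d +ᵥ ΣD cs ds

    -- Modulo constants, c ↦ D c e is injective and its image meets the span of all O a and D c d (d in ds) only in 0.
    Fresh : ∀ {m} → G p n → Vec (G p n) m → Set
    Fresh e ds = ∀ b a cs → Null (D b e +ᵥ (O a +ᵥ ΣD cs ds)) → b ≡ 0ᵥ

    module _
      (fresh : ∀ {m} (ds : Vec (G p n) m) → m ℕ.≤ 3 → ∃ λ e → Fresh e ds)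
      (fresh-in : ∀ {m} x d (ds : Vec (G p n) m) → m ℕ.≤ 3 → In x d → ∃ λ e → In x e × Fresh e ds)
      (φ : X → G p n → 𝔽)
      (φ-parallelogram : ∀ {x a b c} → In x a → In x b → In x c → φ x (b +ᵥ (c -ᵥ a)) ⊕ φ x a ≡ φ x b ⊕ φ x c)
      (φ-0 : ∀ {x} → In x 0ᵥ → φ x 0ᵥ ≡ 0𝔽)
      (lift : ∀ d → ∃ λ f → ∀ x → In x d → ev f x ≡ φ x d)
      where

      open +ᵥ-Solver

      private
        module Dˡ d = AdditiveMap +ᵥ-isAbelianGroup +ᵥ-isAbelianGroup (λ c → D c d) (λ b c → D-+ˡ b c d)
        module Dʳ c = AdditiveMap +ᵥ-isAbelianGroup +ᵥ-isAbelianGroup (D c) (D-+ʳ c)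
        module O = AdditiveMap +ᵥ-isAbelianGroup +ᵥ-isAbelianGroup O O-+
        module ev x = AdditiveMap +ᵥ-isAbelianGroup ⊕-isAbelianGroup (λ f → ev f x) (λ f g → ev-+ f g x)

      Lift : G p n → G p w → Set
      Lift d f = ∀ x → In x d → ev f x ≡ φ x d

      S : G p k → G p n → G p w
      S c d = O c +ᵥ D c d

      -- Joint independence of the spaces at o and o + d, since together they are spanned by the
      -- `O a` and the `D b d`. Independence of the space at o + d alone is the case a = b. `Gen₂`
      -- and `Gen₃` add further points in the same way.
      Gen₁ : G p n → Set
      Gen₁ d = ∀ a b → Null (O a +ᵥ D b d) → a ≡ 0ᵥ × b ≡ 0ᵥ

      Gen₂ : G p n → G p n → Set
      Gen₂ d d′ = ∀ a b c → Null (O a +ᵥ (D b d +ᵥ D c d′)) → a ≡ 0ᵥ × b ≡ 0ᵥ × c ≡ 0ᵥ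

      Gen₃ : G p n → G p n → G p n → Set
      Gen₃ d d′ d″ = ∀ a b c e → Null (O a +ᵥ (D b d +ᵥ (D c d′ +ᵥ D e d″))) →
        a ≡ 0ᵥ × b ≡ 0ᵥ × c ≡ 0ᵥ × e ≡ 0ᵥ

      -- Genericity conditions supplied by fresh points.

      Fresh-drop₁ : ∀ {m e d} {ds : Vec (G p n) m} → Fresh e (d ∷ ds) → Fresh e ds
      Fresh-drop₁ {e = e} {d} {ds} h b a cs null = h b a (0ᵥ ∷ cs) (subst Null
        (trans (solve 3 (λ x y z → x :+ (y :+ z) ⊜ x :+ (y :+ (:0 :+ z))) refl (D b e) (O a) (ΣD cs ds))
          (cong (λ z → D b e +ᵥ (O a +ᵥ (z +ᵥ ΣD cs ds))) (sym (Dˡ.f-0 d)))) null)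

      Fresh-drop₂ : ∀ {m e d d′} {ds : Vec (G p n) m} → Fresh e (d ∷ d′ ∷ ds) → Fresh e (d ∷ ds)
      Fresh-drop₂ {e = e} {d} {d′} {ds} h b a (c ∷ cs) null = h b a (c ∷ 0ᵥ ∷ cs) (subst Null
        (trans (solve 4 (λ x y u z → x :+ (y :+ (u :+ z)) ⊜ x :+ (y :+ (u :+ (:0 :+ z)))) refl (D b e) (O a) (D c d) (ΣD cs ds))
          (cong (λ z → D b e +ᵥ (O a +ᵥ (D c d +ᵥ (z +ᵥ ΣD cs ds)))) (sym (Dˡ.f-0 d′)))) null)

      Fresh-drop₃ : ∀ {m e d d′ d″} {ds : Vec (G p n) m} → Fresh e (d ∷ d′ ∷ d″ ∷ ds) → Fresh e (d ∷ d′ ∷ ds)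
      Fresh-drop₃ {e = e} {d} {d′} {d″} {ds} h b a (c ∷ c′ ∷ cs) null = h b a (c ∷ c′ ∷ 0ᵥ ∷ cs) (subst Null
        (trans (solve 5 (λ x y u v z → x :+ (y :+ (u :+ (v :+ z))) ⊜ x :+ (y :+ (u :+ (v :+ (:0 :+ z))))) refl (D b e) (O a) (D c d) (D c′ d′) (ΣD cs ds))
          (cong (λ z → D b e +ᵥ (O a +ᵥ (D c d +ᵥ (D c′ d′ +ᵥ (z +ᵥ ΣD cs ds))))) (sym (Dˡ.f-0 d″)))) null)

      Gen₁-intro : ∀ {d} → (∀ a b → Null (O a +ᵥ D b d) → b ≡ 0ᵥ) → Gen₁ d
      Gen₁-intro {d} h a b null with refl ← h a b null =
        O-independent a (subst Null (trans (cong (O a +ᵥ_) (Dˡ.f-0 d)) (𝔾.identityʳ (O a))) null) , refl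

      Gen₂-intro : ∀ {d d′} → Gen₁ d → (∀ a b c → Null (O a +ᵥ (D b d +ᵥ D c d′)) → c ≡ 0ᵥ) → Gen₂ d d′
      Gen₂-intro {d} {d′} gen h a b c null with refl ← h a b c null =
        let a≡0 , b≡0 = gen a b (subst Null (cong (O a +ᵥ_) (trans (cong (D b d +ᵥ_) (Dˡ.f-0 d′)) (𝔾.identityʳ (D b d)))) null)
        in a≡0 , b≡0 , refl

      Fresh⇒Gen₁ : ∀ {e} → Fresh e [] → Gen₁ e
      Fresh⇒Gen₁ {e} h = Gen₁-intro λ a b null → h b a [] (subst Null
        (solve 2 (λ x y → x :+ y ⊜ y :+ (x :+ :0)) refl (O a) (D b e)) null)

      -- In `D b (d +ᵥ e)` the fresh point carries the coefficient b, so freshness kills b whatever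
      -- d is. In this way degenerate points are moved to generic ones.
      Fresh⇒Gen₁-+ : ∀ {e d} → Fresh e (d ∷ []) → Gen₁ (d +ᵥ e)
      Fresh⇒Gen₁-+ {e} {d} h = Gen₁-intro λ a b null → h b a (b ∷ []) (subst Null
        (trans (cong (O a +ᵥ_) (D-+ʳ b d e))
          (solve 3 (λ x y z → x :+ (y :+ z) ⊜ z :+ (x :+ (y :+ :0))) refl (O a) (D b d) (D b e))) null)

      Fresh⇒Gen₂ : ∀ {e d} → Gen₁ d → Fresh e (d ∷ []) → Gen₂ d e
      Fresh⇒Gen₂ {e} {d} gen h = Gen₂-intro gen λ a b c null → h c a (b ∷ []) (subst Null
        (solve 3 (λ x y z → x :+ (y :+ z) ⊜ z :+ (x :+ (y :+ :0))) refl (O a) (D b d) (D c e)) null)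

      Gen₃-intro : ∀ {d d′ d″} → Gen₂ d d′ → (∀ a b c e → Null (O a +ᵥ (D b d +ᵥ (D c d′ +ᵥ D e d″))) → e ≡ 0ᵥ) → Gen₃ d d′ d″
      Gen₃-intro {d} {d′} {d″} gen h a b c e null =
        let e≡0 = h a b c e null
            a≡0 , b≡0 , c≡0 = gen a b c (subst Null (cong (λ z → O a +ᵥ (D b d +ᵥ z))
              (trans (cong (λ e → D c d′ +ᵥ D e d″) e≡0) (trans (cong (D c d′ +ᵥ_) (Dˡ.f-0 d″)) (𝔾.identityʳ (D c d′))))) null)
        in a≡0 , b≡0 , c≡0 , e≡0

      Fresh⇒Gen₃ : ∀ {e d d′} → Gen₂ d d′ → Fresh e (d ∷ d′ ∷ []) → Gen₃ d d′ e
      Fresh⇒Gen₃ {e} {d} {d′} gen h = Gen₃-intro gen λ a b b′ c null → h c a (b ∷ b′ ∷ []) (subst Null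
        (solve 4 (λ x y y′ z → x :+ (y :+ (y′ :+ z)) ⊜ z :+ (x :+ (y :+ (y′ :+ :0)))) refl (O a) (D b d) (D b′ d′) (D c e)) null)

      Fresh⇒Gen₂-+ˡ : ∀ {e d d′} → Gen₁ (d +ᵥ d′) → Fresh e (d ∷ d′ ∷ []) → Gen₂ (d +ᵥ d′) e
      Fresh⇒Gen₂-+ˡ {e} {d} {d′} gen h = Gen₂-intro gen λ a b c null → h c a (b ∷ b ∷ []) (subst Null
        (trans (cong (λ z → O a +ᵥ (z +ᵥ D c e)) (D-+ʳ b d d′))
          (solve 4 (λ x y y′ z → x :+ ((y :+ y′) :+ z) ⊜ z :+ (x :+ (y :+ (y′ :+ :0)))) refl (O a) (D b d) (D b d′) (D c e))) null)

      Fresh⇒Gen₂-+ʳ : ∀ {e d d′} → Gen₁ d′ → Fresh e (d ∷ d′ ∷ []) → Gen₂ d′ (d +ᵥ e)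
      Fresh⇒Gen₂-+ʳ {e} {d} {d′} gen h = Gen₂-intro gen λ a b c null → h c a (c ∷ b ∷ []) (subst Null
        (trans (cong (λ z → O a +ᵥ (D b d′ +ᵥ z)) (D-+ʳ c d e))
          (solve 4 (λ x y y′ z → x :+ (y′ :+ (y :+ z)) ⊜ z :+ (x :+ (y :+ (y′ :+ :0)))) refl (O a) (D c d) (D b d′) (D c e))) null)

      Fresh⇒Gen₂-++ : ∀ {e e′ d d′} → Gen₁ (d +ᵥ e) → Fresh e′ (d ∷ d′ ∷ e ∷ []) → Gen₂ (d +ᵥ e) (d′ +ᵥ e′)
      Fresh⇒Gen₂-++ {e} {e′} {d} {d′} gen h = Gen₂-intro gen λ a b c null → h c a (b ∷ c ∷ b ∷ []) (subst Null
        (trans (cong₂ (λ y z → O a +ᵥ (y +ᵥ z)) (D-+ʳ b d e) (D-+ʳ c d′ e′))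
          (solve 5 (λ o x y x′ y′ → o :+ ((x :+ y) :+ (x′ :+ y′)) ⊜ y′ :+ (o :+ (x :+ (x′ :+ (y :+ :0)))))
            refl (O a) (D b d) (D b e) (D c d′) (D c e′))) null)

      Gen₂-sym : ∀ {d d′} → Gen₂ d d′ → Gen₂ d′ d
      Gen₂-sym {d} {d′} gen a b c null =
        let a≡0 , c≡0 , b≡0 = gen a c b (subst Null (cong (O a +ᵥ_) (𝔾.comm (D b d′) (D c d))) null)
        in a≡0 , b≡0 , c≡0

      Gen₂⇒Gen₁ : ∀ {d d′} → Gen₂ d d′ → Gen₁ d
      Gen₂⇒Gen₁ {d} {d′} gen a b null =
        let a≡0 , b≡0 , _ = gen a b 0ᵥ (subst Null (cong (O a +ᵥ_) (sym (trans (cong (D b d +ᵥ_) (Dˡ.f-0 d′)) (𝔾.identityʳ (D b d))))) null)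
        in a≡0 , b≡0

      Gen₂⇒Gen₁-+ : ∀ {d d′} → Gen₂ d d′ → Gen₁ (d +ᵥ d′)
      Gen₂⇒Gen₁-+ {d} {d′} gen a b null =
        let a≡0 , b≡0 , _ = gen a b b (subst Null (cong (O a +ᵥ_) (D-+ʳ b d d′)) null)
        in a≡0 , b≡0

      -- Lifts at one point and around a parallelogram.

      Lift-shift : ∀ {d f} c → Lift d f → Lift d (f +ᵥ S c d)
      Lift-shift {d} {f} c h x x∈ =
        trans (ev-+ f (S c d) x) (trans (cong₂ _⊕_ (h x x∈) (ev-vanishes c x∈)) (⊕-identityʳ (φ x d)))

      Lift-unique : ∀ {d f g} → Gen₁ d → Lift d f → Lift d g → ∃ λ c → g ≡ f +ᵥ S c d
      Lift-unique {d} {f} {g} gen hf hg =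
        let c , eq = vanishing₁ d (g -ᵥ f) (λ a null → proj₁ (gen a a null))
              (λ x x∈ → trans (ev.f-sub x g f) (trans (cong₂ _⊖_ (hg x x∈) (hf x x∈)) (⊕-inverseʳ (φ x d))))
        in c , trans (solve 2 (λ f g → g ⊜ f :+ (g :- f)) refl f g) (cong (f +ᵥ_) eq)

      -- An x lying over three vertices lies over the fourth as well, and there `φ` obeys the
      -- parallelogram law. So the alternating sum of the lifts vanishes on the common zeros of the
      -- three spaces, and `vanishing₃` applies.
      Lift-parallelogram : ∀ {e u v f₁ f₂ f₃ f₄} →
        (∀ a b c → Null (S a e +ᵥ (D b u +ᵥ D c v)) → a ≡ 0ᵥ × b ≡ 0ᵥ × c ≡ 0ᵥ) →
        Lift e f₁ → Lift (e +ᵥ u) f₂ → Lift (e +ᵥ v) f₃ → Lift (e +ᵥ (u +ᵥ v)) f₄ →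
        ∃ λ a → ∃ λ b → ∃ λ c → f₁ +ᵥ f₄ ≡ (f₂ +ᵥ f₃) +ᵥ (S a e +ᵥ (D b u +ᵥ D c v))
      Lift-parallelogram {e} {u} {v} {f₁} {f₂} {f₃} {f₄} indep h₁ h₂ h₃ h₄ =
        let a , b , c , eq = vanishing₃ e u v ((f₁ +ᵥ f₄) -ᵥ (f₂ +ᵥ f₃)) indep vanishes
        in a , b , c , trans (solve 2 (λ f g → g ⊜ f :+ (g :- f)) refl (f₂ +ᵥ f₃) (f₁ +ᵥ f₄)) (cong ((f₂ +ᵥ f₃) +ᵥ_) eq)
        where
          vanishes : ∀ x → In x e → In x (e +ᵥ u) → In x (e +ᵥ v) → ev ((f₁ +ᵥ f₄) -ᵥ (f₂ +ᵥ f₃)) x ≡ 0𝔽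
          vanishes x i₁ i₂ i₃ = begin
            ev ((f₁ +ᵥ f₄) -ᵥ (f₂ +ᵥ f₃)) x ≡⟨ trans (ev.f-sub x _ _) (cong₂ _⊖_ (ev-+ f₁ f₄ x) (ev-+ f₂ f₃ x)) ⟩
            (ev f₁ x ⊕ ev f₄ x) ⊖ (ev f₂ x ⊕ ev f₃ x)
              ≡⟨ cong₂ _⊖_ (cong₂ _⊕_ (h₁ x i₁) (h₄ x (subst (In x) fourth i₄))) (cong₂ _⊕_ (h₂ x i₂) (h₃ x i₃)) ⟩
            (φ x e ⊕ φ x (e +ᵥ (u +ᵥ v))) ⊖ (φ x (e +ᵥ u) ⊕ φ x (e +ᵥ v))
              ≡⟨ cong (_⊖ (φ x (e +ᵥ u) ⊕ φ x (e +ᵥ v))) (trans (⊕-comm (φ x e) _) (trans (cong (λ d → φ x d ⊕ φ x e) (sym fourth)) (φ-parallelogram i₁ i₂ i₃))) ⟩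
            (φ x (e +ᵥ u) ⊕ φ x (e +ᵥ v)) ⊖ (φ x (e +ᵥ u) ⊕ φ x (e +ᵥ v)) ≡⟨ ⊕-inverseʳ _ ⟩
            0𝔽 ∎
            where
              i₄ = In-parallelogram i₁ i₂ i₃
              fourth : (e +ᵥ u) +ᵥ ((e +ᵥ v) -ᵥ e) ≡ e +ᵥ (u +ᵥ v)
              fourth = solve 3 (λ e u v → (e :+ u) :+ ((e :+ v) :- e) ⊜ e :+ (u :+ v)) refl e u v

      -- The canonical lift at a generic point.

      -- The lift at 0 is fixed to be the zero function. Compatibility then says that the lifts
      -- around 0, d, d′, d + d′ can be completed with alternating sum exactly zero.
      Compatible : G p n → G p w → G p n → Set
      Compatible d f d′ = Lift d f × ∃ λ f′ → Lift d′ f′ × Lift (d +ᵥ d′) (f +ᵥ f′)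

      Lift-0 : Lift 0ᵥ 0ᵥ
      Lift-0 x x∈ = trans (ev.f-0 x) (sym (φ-0 x∈))

      -- The error O a + D b d + D c d′ of arbitrary lifts is absorbed by shifting all three of them.
      Compatible-exists : ∀ {d d′} → Gen₂ d d′ → ∃ λ f → Compatible d f d′
      Compatible-exists {d} {d′} gen =
        let f , hf = lift d
            f′ , hf′ = lift d′
            g , hg = lift (d +ᵥ d′)
            a , b , c , eq = Lift-parallelogram {0ᵥ} {d} {d′} indep Lift-0
               (subst (λ z → Lift z f) (sym (𝔾.identityˡ d)) hf)
               (subst (λ z → Lift z f′) (sym (𝔾.identityˡ d′)) hf′)
               (subst (λ z → Lift z g) (sym (𝔾.identityˡ (d +ᵥ d′))) hg)
        -- Shifts r, r′, s of the lifts at d, d′, d + d′ must satisfy a + s = r + r′ on the `O`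
        -- part, b + s = r on the d part and c + s = r′ on the d′ part. The only solution is r = a -
        -- c, r′ = a - b, s = a - (b + c).
        in f +ᵥ S (a -ᵥ c) d , Lift-shift {d} (a -ᵥ c) hf ,
           f′ +ᵥ S (a -ᵥ b) d′ , Lift-shift {d′} (a -ᵥ b) hf′ ,
           subst (Lift (d +ᵥ d′)) (combined f f′ g a b c eq) (Lift-shift {d +ᵥ d′} (a -ᵥ (b +ᵥ c)) hg)
        where
          indep : ∀ a b c → Null (S a 0ᵥ +ᵥ (D b d +ᵥ D c d′)) → a ≡ 0ᵥ × b ≡ 0ᵥ × c ≡ 0ᵥ
          indep a b c null = gen a b c (subst Null
            (cong (_+ᵥ (D b d +ᵥ D c d′)) (trans (cong (O a +ᵥ_) (Dʳ.f-0 a)) (𝔾.identityʳ (O a)))) null)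
          combined : ∀ f f′ g a b c → 0ᵥ +ᵥ g ≡ (f +ᵥ f′) +ᵥ (S a 0ᵥ +ᵥ (D b d +ᵥ D c d′)) →
            g +ᵥ S (a -ᵥ (b +ᵥ c)) (d +ᵥ d′) ≡ (f +ᵥ S (a -ᵥ c) d) +ᵥ (f′ +ᵥ S (a -ᵥ b) d′)
          combined f f′ g a b c eq = begin
            g +ᵥ (O (a -ᵥ (b +ᵥ c)) +ᵥ D (a -ᵥ (b +ᵥ c)) (d +ᵥ d′))
              ≡⟨ cong₂ _+ᵥ_ (trans (sym (𝔾.identityˡ g)) eq) (cong₂ _+ᵥ_ (sub₂ O O-+)
                   (trans (D-+ʳ (a -ᵥ (b +ᵥ c)) d d′) (cong₂ _+ᵥ_ (sub₂ (λ c → D c d) (λ b c → D-+ˡ b c d)) (sub₂ (λ c → D c d′) (λ b c → D-+ˡ b c d′))))) ⟩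
            ((f +ᵥ f′) +ᵥ ((O a +ᵥ D a 0ᵥ) +ᵥ (D b d +ᵥ D c d′))) +ᵥ
              ((O a -ᵥ (O b +ᵥ O c)) +ᵥ ((D a d -ᵥ (D b d +ᵥ D c d)) +ᵥ (D a d′ -ᵥ (D b d′ +ᵥ D c d′))))
              ≡⟨ cong (λ z → ((f +ᵥ f′) +ᵥ ((O a +ᵥ z) +ᵥ (D b d +ᵥ D c d′))) +ᵥ
                   ((O a -ᵥ (O b +ᵥ O c)) +ᵥ ((D a d -ᵥ (D b d +ᵥ D c d)) +ᵥ (D a d′ -ᵥ (D b d′ +ᵥ D c d′))))) (Dʳ.f-0 a) ⟩
            ((f +ᵥ f′) +ᵥ ((O a +ᵥ 0ᵥ) +ᵥ (D b d +ᵥ D c d′))) +ᵥ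
              ((O a -ᵥ (O b +ᵥ O c)) +ᵥ ((D a d -ᵥ (D b d +ᵥ D c d)) +ᵥ (D a d′ -ᵥ (D b d′ +ᵥ D c d′))))
              ≡⟨ solve 11 (λ f f′ oa ob oc ad bd cd ad′ bd′ cd′ →
                   ((f :+ f′) :+ ((oa :+ :0) :+ (bd :+ cd′))) :+ ((oa :- (ob :+ oc)) :+ ((ad :- (bd :+ cd)) :+ (ad′ :- (bd′ :+ cd′))))
                   ⊜ (f :+ ((oa :- oc) :+ (ad :- cd))) :+ (f′ :+ ((oa :- ob) :+ (ad′ :- bd′))))
                   refl f f′ (O a) (O b) (O c) (D a d) (D b d) (D c d) (D a d′) (D b d′) (D c d′) ⟩
            (f +ᵥ ((O a -ᵥ O c) +ᵥ (D a d -ᵥ D c d))) +ᵥ (f′ +ᵥ ((O a -ᵥ O b) +ᵥ (D a d′ -ᵥ D b d′)))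
              ≡⟨ sym (cong₂ (λ y z → (f +ᵥ y) +ᵥ (f′ +ᵥ z)) (cong₂ _+ᵥ_ (O.f-sub a c) (Dˡ.f-sub d a c)) (cong₂ _+ᵥ_ (O.f-sub a b) (Dˡ.f-sub d′ a b))) ⟩
            (f +ᵥ S (a -ᵥ c) d) +ᵥ (f′ +ᵥ S (a -ᵥ b) d′) ∎
            where
              sub₂ : (h : G p k → G p w) (h-+ : ∀ b c → h (b +ᵥ c) ≡ h b +ᵥ h c) → h (a -ᵥ (b +ᵥ c)) ≡ h a -ᵥ (h b +ᵥ h c)
              sub₂ h h-+ = trans (AdditiveMap.f-sub +ᵥ-isAbelianGroup +ᵥ-isAbelianGroup h h-+ a (b +ᵥ c)) (cong (λ z → h a -ᵥ z) (h-+ b c))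

      Lift-S-0 : ∀ {d f g c} → g ≡ f +ᵥ S c d → c ≡ 0ᵥ → g ≡ f
      Lift-S-0 {d} {f} eq refl = trans eq (trans (cong₂ (λ y z → f +ᵥ (y +ᵥ z)) O.f-0 (Dˡ.f-0 d))
        (solve 1 (λ f → f :+ (:0 :+ :0) ⊜ f) refl f))

      -- The lifts f′, g′, f + f′, g + g′ sit on the parallelogram d′, d″, d + d′, d + d″ and have
      -- alternating sum g - f. This writes g - f = `S h d` as `O a` + `D c d` + `D (a - b) d′` +
      -- `D b d″`. Joint independence makes the d′ and d″ coefficients vanish, so a = b = 0, while
      -- the `O` parts give h = a.
      Compatible-unique₃ : ∀ {d d′ d″ f g} → Gen₃ d d′ d″ → Compatible d f d′ → Compatible d g d″ → g ≡ f
      Compatible-unique₃ {d} {d′} {d″} {f} {g} gen (hf , f′ , hf′ , hff′) (hg , g′ , hg′ , hgg′) =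
        let h , g≡ = Lift-unique {d} {f} {g} (λ a b null → gen₁ a b null) hf hg
            a , b , c , eq = Lift-parallelogram {d′} {d″ -ᵥ d′} {d} indep hf′
              (subst (λ z → Lift z g′) (solve 2 (λ x y → y ⊜ x :+ (y :- x)) refl d′ d″) hg′)
              (subst (λ z → Lift z (f +ᵥ f′)) (𝔾.comm d d′) hff′)
              (subst (λ z → Lift z (g +ᵥ g′)) (solve 3 (λ x y z → z :+ y ⊜ x :+ ((y :- x) :+ z)) refl d′ d″ d) hgg′)
        in Lift-S-0 {d} g≡ (h≡0 h a b c (trans (sym (difference h g≡)) (cancel a b c eq)))
        where
          gen₁ : Gen₁ d
          gen₁ a b null =
            let a≡0 , b≡0 , _ = gen a b 0ᵥ 0ᵥ (subst Null (trans
                  (solve 2 (λ x y → x :+ y ⊜ x :+ (y :+ (:0 :+ :0))) refl (O a) (D b d))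
                  (cong₂ (λ y z → O a +ᵥ (D b d +ᵥ (y +ᵥ z))) (sym (Dˡ.f-0 d′)) (sym (Dˡ.f-0 d″)))) null)
            in a≡0 , b≡0
          expand : ∀ a b c → S a d′ +ᵥ (D b (d″ -ᵥ d′) +ᵥ D c d) ≡ O a +ᵥ (D c d +ᵥ (D (a -ᵥ b) d′ +ᵥ D b d″))
          expand a b c = trans (cong (λ z → S a d′ +ᵥ (z +ᵥ D c d)) (Dʳ.f-sub b d″ d′)) (trans
            (solve 5 (λ o x y z w → (o :+ x) :+ ((y :- z) :+ w) ⊜ o :+ (w :+ ((x :- z) :+ y))) refl (O a) (D a d′) (D b d″) (D b d′) (D c d))
            (cong (λ z → O a +ᵥ (D c d +ᵥ (z +ᵥ D b d″))) (sym (Dˡ.f-sub d′ a b))))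
          indep : ∀ a b c → Null (S a d′ +ᵥ (D b (d″ -ᵥ d′) +ᵥ D c d)) → a ≡ 0ᵥ × b ≡ 0ᵥ × c ≡ 0ᵥ
          indep a b c null =
            let a≡0 , c≡0 , _ , b≡0 = gen a c (a -ᵥ b) b (subst Null (expand a b c) null)
            in a≡0 , b≡0 , c≡0
          difference : ∀ h → g ≡ f +ᵥ S h d → g -ᵥ f ≡ S h d
          difference h eq = trans (cong (_-ᵥ f) eq) (solve 2 (λ f s → (f :+ s) :- f ⊜ s) refl f (S h d))
          cancel : ∀ a b c → f′ +ᵥ (g +ᵥ g′) ≡ (g′ +ᵥ (f +ᵥ f′)) +ᵥ (S a d′ +ᵥ (D b (d″ -ᵥ d′) +ᵥ D c d)) →
            g -ᵥ f ≡ S a d′ +ᵥ (D b (d″ -ᵥ d′) +ᵥ D c d)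
          cancel a b c eq = begin
            g -ᵥ f ≡⟨ solve 4 (λ f f′ g g′ → g :- f ⊜ (f′ :+ (g :+ g′)) :- (g′ :+ (f :+ f′))) refl f f′ g g′ ⟩
            (f′ +ᵥ (g +ᵥ g′)) -ᵥ (g′ +ᵥ (f +ᵥ f′)) ≡⟨ cong (_-ᵥ (g′ +ᵥ (f +ᵥ f′))) eq ⟩
            ((g′ +ᵥ (f +ᵥ f′)) +ᵥ (S a d′ +ᵥ (D b (d″ -ᵥ d′) +ᵥ D c d))) -ᵥ (g′ +ᵥ (f +ᵥ f′))
              ≡⟨ solve 2 (λ x y → (x :+ y) :- x ⊜ y) refl (g′ +ᵥ (f +ᵥ f′)) (S a d′ +ᵥ (D b (d″ -ᵥ d′) +ᵥ D c d)) ⟩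
            S a d′ +ᵥ (D b (d″ -ᵥ d′) +ᵥ D c d) ∎
          h≡0 : ∀ h a b c → S h d ≡ S a d′ +ᵥ (D b (d″ -ᵥ d′) +ᵥ D c d) → h ≡ 0ᵥ
          h≡0 h a b c eq =
            let h-a≡0 , _ , a-b≡0 , b≡0 = gen (a -ᵥ h) (c -ᵥ h) (a -ᵥ b) b (subst Null (sym cancels) null-0)
                a≡b = 𝔾ₚ.x∙y⁻¹≈ε⇒x≈y a b a-b≡0
            in trans (sym (𝔾ₚ.x∙y⁻¹≈ε⇒x≈y a h h-a≡0)) (trans a≡b b≡0)
            where
              cancels : O (a -ᵥ h) +ᵥ (D (c -ᵥ h) d +ᵥ (D (a -ᵥ b) d′ +ᵥ D b d″)) ≡ 0ᵥ
              cancels = begin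
                O (a -ᵥ h) +ᵥ (D (c -ᵥ h) d +ᵥ (D (a -ᵥ b) d′ +ᵥ D b d″))
                  ≡⟨ cong₂ (λ y z → y +ᵥ (z +ᵥ (D (a -ᵥ b) d′ +ᵥ D b d″))) (O.f-sub a h) (Dˡ.f-sub d c h) ⟩
                (O a -ᵥ O h) +ᵥ ((D c d -ᵥ D h d) +ᵥ (D (a -ᵥ b) d′ +ᵥ D b d″))
                  ≡⟨ solve 6 (λ o o′ x x′ y z → (o :- o′) :+ ((x :- x′) :+ (y :+ z)) ⊜ (o :+ (x :+ (y :+ z))) :- (o′ :+ x′))
                       refl (O a) (O h) (D c d) (D h d) (D (a -ᵥ b) d′) (D b d″) ⟩
                (O a +ᵥ (D c d +ᵥ (D (a -ᵥ b) d′ +ᵥ D b d″))) -ᵥ S h d ≡⟨ cong (_-ᵥ S h d) (trans (sym (expand a b c)) (sym eq)) ⟩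
                S h d -ᵥ S h d ≡⟨ 𝔾.inverseʳ (S h d) ⟩
                0ᵥ ∎

      -- The points d, d′, d″ need not be jointly generic, and d′ and d″ may even coincide. Both f
      -- and g are compared with a lift compatible with a point fresh for all three.
      Compatible-unique : ∀ {d d′ d″ f g} → Gen₂ d d′ → Gen₂ d d″ → Compatible d f d′ → Compatible d g d″ → f ≡ g
      Compatible-unique {d} {d′} {d″} {f} {g} gen′ gen″ rf rg =
        let e , fr = fresh (d ∷ d′ ∷ d″ ∷ []) (ℕₚ.≤-refl)
            s , rs = Compatible-exists (Fresh⇒Gen₂ (Gen₂⇒Gen₁ {d} {d′} gen′) (Fresh-drop₂ (Fresh-drop₃ fr)))
        in trans (sym (Compatible-unique₃ (Fresh⇒Gen₃ gen′ (Fresh-drop₃ fr)) rf rs)) (Compatible-unique₃ (Fresh⇒Gen₃ gen″ (Fresh-drop₂ fr)) rg rs)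

      Canonical : G p n → G p w → Set
      Canonical d f = ∀ d′ → Gen₂ d d′ → Compatible d f d′

      abstract
        -- A lift is chosen by testing against one fresh point. Every other admissible point has a
        -- compatible lift of its own, and uniqueness identifies it with the chosen one.
        Canonical-exists : ∀ {d} → Gen₁ d → ∃ λ f → Canonical d f
        Canonical-exists {d} gen =
          let e , fr = fresh (d ∷ []) (ℕ.s≤s ℕ.z≤n)
              gen₂ = Fresh⇒Gen₂ gen fr
              f , rf = Compatible-exists gen₂
          in f , λ d′ gen′ → let g , rg = Compatible-exists gen′ in
               subst (λ z → Compatible d z d′) (Compatible-unique gen′ gen₂ rg rf) rg

      Canonical⇒Lift : ∀ {d f} → Gen₁ d → Canonical d f → Lift d f
      Canonical⇒Lift {d} gen cf =
        let e , fr = fresh (d ∷ []) (ℕ.s≤s ℕ.z≤n)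
        in proj₁ (cf e (Fresh⇒Gen₂ gen fr))

      -- Compatibility is symmetric in the two points: the partner of f at d′ is itself compatible
      -- with d, so uniqueness makes it the canonical f′.
      Canonical-Lift-+ : ∀ {d d′ f f′} → Gen₂ d d′ → Canonical d f → Canonical d′ f′ → Lift (d +ᵥ d′) (f +ᵥ f′)
      Canonical-Lift-+ {d} {d′} {f} {f′} gen cf cf′ =
        let hf , f″ , hf″ , hff″ = cf d′ gen
            gen′ = Gen₂-sym gen
            f″≡f′ = Compatible-unique gen′ gen′
              (hf″ , f , hf , subst₂ Lift (𝔾.comm d d′) (𝔾.comm f f″) hff″) (cf′ d gen′)
        in subst (λ z → Lift (d +ᵥ d′) (f +ᵥ z)) f″≡f′ hff″

      -- Both g and f + f′ are lifts at d + d′, so they differ by `S h (d +ᵥ d′)`, which involves no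
      -- other point. For a fresh e with canonical lift s, the lifts s, f + s, f′ + s, g + s around
      -- e, e + d, e + d′, e + d + d′ write the same difference as `S a e` + `D b d` + `D c d′`. The
      -- term `D a e` has no counterpart, so a = 0, and the `O` parts give h = a.
      Canonical-+ : ∀ {d d′ f f′ g} → Gen₂ d d′ → Canonical d f → Canonical d′ f′ → Canonical (d +ᵥ d′) g → g ≡ f +ᵥ f′
      Canonical-+ {d} {d′} {f} {f′} {g} gen cf cf′ cg =
        let e , fr = fresh (d ∷ d′ ∷ []) (ℕ.s≤s (ℕ.s≤s ℕ.z≤n))
            gen₊ = Gen₂⇒Gen₁-+ gen
            gen₃ = Fresh⇒Gen₃ gen fr
            s , cs = Canonical-exists (Fresh⇒Gen₁ (Fresh-drop₁ (Fresh-drop₁ fr)))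
            h , g≡ = Lift-unique {d +ᵥ d′} {f +ᵥ f′} {g} gen₊ (Canonical-Lift-+ gen cf cf′) (Canonical⇒Lift gen₊ cg)
            a , b , c , eq = Lift-parallelogram {e} {d} {d′} (indep e gen₃)
              (Canonical⇒Lift (Fresh⇒Gen₁ (Fresh-drop₁ (Fresh-drop₁ fr))) cs)
              (subst (λ z → Lift z (f +ᵥ s)) (𝔾.comm d e)
                (Canonical-Lift-+ (Fresh⇒Gen₂ (Gen₂⇒Gen₁ gen) (Fresh-drop₂ fr)) cf cs))
              (subst (λ z → Lift z (f′ +ᵥ s)) (𝔾.comm d′ e)
                (Canonical-Lift-+ (Fresh⇒Gen₂ (Gen₂⇒Gen₁ (Gen₂-sym gen)) (Fresh-drop₁ fr)) cf′ cs))
              (subst (λ z → Lift z (g +ᵥ s)) (𝔾.comm (d +ᵥ d′) e)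
                (Canonical-Lift-+ (Fresh⇒Gen₂-+ˡ gen₊ fr) cg cs))
        in Lift-S-0 {d +ᵥ d′} g≡ (h≡0 e gen₃ h a b c (trans (sym (difference h g≡)) (cancel s e a b c eq)))
        where
          indep : ∀ e → Gen₃ d d′ e → ∀ a b c → Null (S a e +ᵥ (D b d +ᵥ D c d′)) → a ≡ 0ᵥ × b ≡ 0ᵥ × c ≡ 0ᵥ
          indep e gen₃ a b c null =
            let a≡0 , b≡0 , c≡0 , _ = gen₃ a b c a (subst Null
                  (solve 4 (λ o x y z → (o :+ x) :+ (y :+ z) ⊜ o :+ (y :+ (z :+ x))) refl (O a) (D a e) (D b d) (D c d′)) null)
            in a≡0 , b≡0 , c≡0
          difference : ∀ h → g ≡ (f +ᵥ f′) +ᵥ S h (d +ᵥ d′) → g -ᵥ (f +ᵥ f′) ≡ S h (d +ᵥ d′)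
          difference h eq = trans (cong (_-ᵥ (f +ᵥ f′)) eq) (solve 2 (λ f s → (f :+ s) :- f ⊜ s) refl (f +ᵥ f′) (S h (d +ᵥ d′)))
          cancel : ∀ s e a b c → s +ᵥ (g +ᵥ s) ≡ ((f +ᵥ s) +ᵥ (f′ +ᵥ s)) +ᵥ (S a e +ᵥ (D b d +ᵥ D c d′)) →
            g -ᵥ (f +ᵥ f′) ≡ S a e +ᵥ (D b d +ᵥ D c d′)
          cancel s e a b c eq = begin
            g -ᵥ (f +ᵥ f′) ≡⟨ solve 4 (λ f f′ g s → g :- (f :+ f′) ⊜ (s :+ (g :+ s)) :- ((f :+ s) :+ (f′ :+ s))) refl f f′ g s ⟩
            (s +ᵥ (g +ᵥ s)) -ᵥ ((f +ᵥ s) +ᵥ (f′ +ᵥ s)) ≡⟨ cong (_-ᵥ ((f +ᵥ s) +ᵥ (f′ +ᵥ s))) eq ⟩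
            (((f +ᵥ s) +ᵥ (f′ +ᵥ s)) +ᵥ (S a e +ᵥ (D b d +ᵥ D c d′))) -ᵥ ((f +ᵥ s) +ᵥ (f′ +ᵥ s))
              ≡⟨ solve 2 (λ x y → (x :+ y) :- x ⊜ y) refl ((f +ᵥ s) +ᵥ (f′ +ᵥ s)) (S a e +ᵥ (D b d +ᵥ D c d′)) ⟩
            S a e +ᵥ (D b d +ᵥ D c d′) ∎
          h≡0 : ∀ e → Gen₃ d d′ e → ∀ h a b c → S h (d +ᵥ d′) ≡ S a e +ᵥ (D b d +ᵥ D c d′) → h ≡ 0ᵥ
          h≡0 e gen₃ h a b c eq =
            let a-h≡0 , _ , _ , a≡0 = gen₃ (a -ᵥ h) (b -ᵥ h) (c -ᵥ h) a (subst Null (sym cancels) null-0)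
            in trans (sym (𝔾ₚ.x∙y⁻¹≈ε⇒x≈y a h a-h≡0)) a≡0
            where
              cancels : O (a -ᵥ h) +ᵥ (D (b -ᵥ h) d +ᵥ (D (c -ᵥ h) d′ +ᵥ D a e)) ≡ 0ᵥ
              cancels = begin
                O (a -ᵥ h) +ᵥ (D (b -ᵥ h) d +ᵥ (D (c -ᵥ h) d′ +ᵥ D a e))
                  ≡⟨ cong₂ _+ᵥ_ (O.f-sub a h) (cong₂ (λ y z → y +ᵥ (z +ᵥ D a e)) (Dˡ.f-sub d b h) (Dˡ.f-sub d′ c h)) ⟩
                (O a -ᵥ O h) +ᵥ ((D b d -ᵥ D h d) +ᵥ ((D c d′ -ᵥ D h d′) +ᵥ D a e))
                  ≡⟨ solve 7 (λ o o′ x x′ y y′ z → (o :- o′) :+ ((x :- x′) :+ ((y :- y′) :+ z)) ⊜ ((o :+ z) :+ (x :+ y)) :- (o′ :+ (x′ :+ y′)))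
                       refl (O a) (O h) (D b d) (D h d) (D c d′) (D h d′) (D a e) ⟩
                (S a e +ᵥ (D b d +ᵥ D c d′)) -ᵥ (O h +ᵥ (D h d +ᵥ D h d′)) ≡⟨ cong₂ _-ᵥ_ (sym eq) (cong (O h +ᵥ_) (sym (D-+ʳ h d d′))) ⟩
                S h (d +ᵥ d′) -ᵥ S h (d +ᵥ d′) ≡⟨ 𝔾.inverseʳ (S h (d +ᵥ d′)) ⟩
                0ᵥ ∎

      -- From canonical lifts to an additive map defined everywhere.

      -- Both sums equal the canonical lift at d + e + e′.
      parallelogram-swap : ∀ {d e e′ f f′ g g′} → Gen₂ (d +ᵥ e) e′ → Gen₂ (d +ᵥ e′) e →
        Canonical e f → Canonical (d +ᵥ e) g → Canonical e′ f′ → Canonical (d +ᵥ e′) g′ → g +ᵥ f′ ≡ g′ +ᵥ f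
      parallelogram-swap {d} {e} {e′} {f} {f′} {g} {g′} gen gen′ cf cg cf′ cg′ =
        let r , cr = Canonical-exists (Gen₂⇒Gen₁-+ gen)
        in trans (sym (Canonical-+ gen cg cf′ cr))
             (Canonical-+ gen′ cg′ cf (subst (λ z → Canonical z r) (solve 3 (λ x y z → (x :+ y) :+ z ⊜ (x :+ z) :+ y) refl d e e′) cr))

      -- The sums needed for a direct comparison of `e₁` with `e₂` may be degenerate, so each is
      -- compared with a point fresh for d, `e₁` and `e₂`.
      shift-difference : ∀ {d e₁ e₂ f₁ f₂ g₁ g₂} → Gen₁ e₁ → Gen₁ (d +ᵥ e₁) → Gen₁ e₂ → Gen₁ (d +ᵥ e₂) →
        Canonical e₁ f₁ → Canonical (d +ᵥ e₁) g₁ → Canonical e₂ f₂ → Canonical (d +ᵥ e₂) g₂ → g₁ -ᵥ f₁ ≡ g₂ -ᵥ f₂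
      shift-difference {d} {e₁} {e₂} {f₁} {f₂} {g₁} {g₂} gen₁ gen₁′ gen₂ gen₂′ cf₁ cg₁ cf₂ cg₂ =
        let e , fr = fresh (d ∷ e₁ ∷ e₂ ∷ []) ℕₚ.≤-refl
            fr₁ = Fresh-drop₃ fr
            fr₂ = Fresh-drop₂ fr
            f , cf = Canonical-exists (Fresh⇒Gen₁ (Fresh-drop₁ (Fresh-drop₁ fr₁)))
            g , cg = Canonical-exists (Fresh⇒Gen₁-+ (Fresh-drop₂ fr₁))
            eq₁ = parallelogram-swap (Fresh⇒Gen₂-+ˡ gen₁′ fr₁) (Gen₂-sym (Fresh⇒Gen₂-+ʳ gen₁ fr₁)) cf₁ cg₁ cf cg
            eq₂ = parallelogram-swap (Fresh⇒Gen₂-+ˡ gen₂′ fr₂) (Gen₂-sym (Fresh⇒Gen₂-+ʳ gen₂ fr₂)) cf₂ cg₂ cf cg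
        in trans (difference f₁ g₁ f g eq₁) (sym (difference f₂ g₂ f g eq₂))
        where
          difference : ∀ f g f′ g′ → g +ᵥ f′ ≡ g′ +ᵥ f → g -ᵥ f ≡ g′ -ᵥ f′
          difference f g f′ g′ eq = begin
            g -ᵥ f ≡⟨ solve 3 (λ f g f′ → g :- f ⊜ (g :+ f′) :- (f :+ f′)) refl f g f′ ⟩
            (g +ᵥ f′) -ᵥ (f +ᵥ f′) ≡⟨ cong (_-ᵥ (f +ᵥ f′)) eq ⟩
            (g′ +ᵥ f) -ᵥ (f +ᵥ f′) ≡⟨ solve 3 (λ f f′ g′ → (g′ :+ f) :- (f :+ f′) ⊜ g′ :- f′) refl f f′ g′ ⟩
            g′ -ᵥ f′ ∎

      abstract
        -- Canonical lifts exist only at generic points, but both e and d + e can be made generic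
        -- for any d. The difference of their lifts thus gives a value at degenerate points too.
        extension-at : ∀ d → ∃ λ m → ∀ {e f g} → Gen₁ e → Gen₁ (d +ᵥ e) → Canonical e f → Canonical (d +ᵥ e) g → m ≡ g -ᵥ f
        extension-at d =
          let e , fr = fresh (d ∷ []) (ℕ.s≤s ℕ.z≤n)
              gen = Fresh⇒Gen₁ (Fresh-drop₁ fr)
              gen′ = Fresh⇒Gen₁-+ fr
              f , cf = Canonical-exists gen
              g , cg = Canonical-exists gen′
          in g -ᵥ f , λ gen₁ gen₁′ cf₁ cg₁ → shift-difference gen gen′ gen₁ gen₁′ cf cg cf₁ cg₁

      extension : G p n → G p w
      extension d = proj₁ (extension-at d)

      -- With increments e for d and e′ for d′, the increment e + e′ serves for d + d′; additivity
      -- of canonical lifts splits both ends of the resulting difference.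
      extension-+-via : ∀ {d d′ e e′ f f′ g g′ s t} →
        Gen₁ e → Gen₁ (d +ᵥ e) → Gen₁ e′ → Gen₁ (d′ +ᵥ e′) → Gen₂ e e′ → Gen₂ (d +ᵥ e) (d′ +ᵥ e′) →
        Canonical e f → Canonical (d +ᵥ e) g → Canonical e′ f′ → Canonical (d′ +ᵥ e′) g′ →
        Canonical (e +ᵥ e′) s → Canonical ((d +ᵥ e) +ᵥ (d′ +ᵥ e′)) t →
        extension (d +ᵥ d′) ≡ extension d +ᵥ extension d′
      extension-+-via {d} {d′} {e} {e′} {f} {f′} {g} {g′} {s} {t} gen-e gen-de gen-e′ gen-de′ gen-ee′ gen-dede′ cf cg cf′ cg′ cs ct = begin
        extension (d +ᵥ d′) ≡⟨ proj₂ (extension-at (d +ᵥ d′)) (Gen₂⇒Gen₁-+ gen-ee′)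
                                 (subst Gen₁ middle (Gen₂⇒Gen₁-+ gen-dede′)) cs (subst (λ z → Canonical z t) middle ct) ⟩
        t -ᵥ s ≡⟨ cong₂ _-ᵥ_ (Canonical-+ gen-dede′ cg cg′ ct) (Canonical-+ gen-ee′ cf cf′ cs) ⟩
        (g +ᵥ g′) -ᵥ (f +ᵥ f′) ≡⟨ solve 4 (λ f f′ g g′ → (g :+ g′) :- (f :+ f′) ⊜ (g :- f) :+ (g′ :- f′)) refl f f′ g g′ ⟩
        (g -ᵥ f) +ᵥ (g′ -ᵥ f′) ≡⟨ sym (cong₂ _+ᵥ_ (proj₂ (extension-at d) gen-e gen-de cf cg) (proj₂ (extension-at d′) gen-e′ gen-de′ cf′ cg′)) ⟩
        extension d +ᵥ extension d′ ∎
        where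
          middle : (d +ᵥ e) +ᵥ (d′ +ᵥ e′) ≡ (d +ᵥ d′) +ᵥ (e +ᵥ e′)
          middle = solve 4 (λ d e d′ e′ → (d :+ e) :+ (d′ :+ e′) ⊜ (d :+ d′) :+ (e :+ e′)) refl d e d′ e′

      extension-+ : ∀ d d′ → extension (d +ᵥ d′) ≡ extension d +ᵥ extension d′
      extension-+ d d′ =
        let e , fr = fresh (d ∷ d′ ∷ []) (ℕ.s≤s (ℕ.s≤s ℕ.z≤n))
            e′ , fr′ = fresh (d ∷ d′ ∷ e ∷ []) ℕₚ.≤-refl
        in via {e} {e′}
             (Fresh⇒Gen₁ (Fresh-drop₁ (Fresh-drop₁ fr))) (Fresh⇒Gen₁-+ (Fresh-drop₂ fr))
             (Fresh⇒Gen₁ (Fresh-drop₁ (Fresh-drop₁ (Fresh-drop₁ fr′)))) (Fresh⇒Gen₁-+ (Fresh-drop₁ (Fresh-drop₃ fr′)))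
             (Fresh-drop₁ (Fresh-drop₁ fr′)) fr′
        where
          via : ∀ {e e′} → Gen₁ e → Gen₁ (d +ᵥ e) → Gen₁ e′ → Gen₁ (d′ +ᵥ e′) →
            Fresh e′ (e ∷ []) → Fresh e′ (d ∷ d′ ∷ e ∷ []) → extension (d +ᵥ d′) ≡ extension d +ᵥ extension d′
          via gen-e gen-de gen-e′ gen-de′ fr fr′ =
            extension-+-via gen-e gen-de gen-e′ gen-de′ gen-ee′ gen-dede′
              (proj₂ (Canonical-exists gen-e)) (proj₂ (Canonical-exists gen-de))
              (proj₂ (Canonical-exists gen-e′)) (proj₂ (Canonical-exists gen-de′))
              (proj₂ (Canonical-exists (Gen₂⇒Gen₁-+ gen-ee′))) (proj₂ (Canonical-exists (Gen₂⇒Gen₁-+ gen-dede′)))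
            where
              gen-ee′ = Fresh⇒Gen₂ gen-e fr
              gen-dede′ = Fresh⇒Gen₂-++ gen-de fr′

      -- The increment `d₁ + d₂ - d` takes d to `d₁ + d₂`, so the value at d is `f₁ + f₂ - f₃`. The
      -- point `d₁ + d₂` need not lie over x, so its lift g is eliminated before evaluating; the
      -- remaining points do lie over x.
      ev-extension-via : ∀ {x d d₁ d₂ f₁ f₂ f₃ g} → In x d → In x d₁ → In x d₂ →
        Gen₁ d₁ → Gen₁ d₂ → Gen₂ d₁ d₂ → Gen₁ (d₁ +ᵥ (d₂ -ᵥ d)) →
        Canonical d₁ f₁ → Canonical d₂ f₂ → Canonical (d₁ +ᵥ (d₂ -ᵥ d)) f₃ → Canonical (d₁ +ᵥ d₂) g →
        ev (extension d) x ≡ φ x d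
      ev-extension-via {x} {d} {d₁} {d₂} {f₁} {f₂} {f₃} {g} x∈ x∈₁ x∈₂ gen₁ gen₂ gen₁₂ gen₃ cf₁ cf₂ cf₃ cg = begin
        ev (extension d) x ≡⟨ cong (λ f → ev f x) (trans
          (proj₂ (extension-at d) gen₃ (subst Gen₁ sum (Gen₂⇒Gen₁-+ gen₁₂)) cf₃ (subst (λ z → Canonical z g) sum cg))
          (cong (_-ᵥ f₃) (Canonical-+ gen₁₂ cf₁ cf₂ cg))) ⟩
        ev ((f₁ +ᵥ f₂) -ᵥ f₃) x ≡⟨ trans (ev.f-sub x (f₁ +ᵥ f₂) f₃) (cong (_⊖ ev f₃ x) (ev-+ f₁ f₂ x)) ⟩
        (ev f₁ x ⊕ ev f₂ x) ⊖ ev f₃ x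
          ≡⟨ cong₂ _⊖_ (cong₂ _⊕_ (Canonical⇒Lift gen₁ cf₁ x x∈₁) (Canonical⇒Lift gen₂ cf₂ x x∈₂))
               (Canonical⇒Lift gen₃ cf₃ x (In-parallelogram x∈ x∈₁ x∈₂)) ⟩
        (φ x d₁ ⊕ φ x d₂) ⊖ φ x (d₁ +ᵥ (d₂ -ᵥ d)) ≡⟨ cong (_⊖ φ x (d₁ +ᵥ (d₂ -ᵥ d))) (sym (φ-parallelogram x∈ x∈₁ x∈₂)) ⟩
        (φ x (d₁ +ᵥ (d₂ -ᵥ d)) ⊕ φ x d) ⊖ φ x (d₁ +ᵥ (d₂ -ᵥ d)) ≡⟨ cancel (φ x (d₁ +ᵥ (d₂ -ᵥ d))) (φ x d) ⟩
        φ x d ∎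
        where
          cancel : ∀ a b → (a ⊕ b) ⊖ a ≡ b
          cancel = ⊕-Solver.solve 2 (λ a b → (a ⊕-Solver.:+ b) ⊕-Solver.:- a ⊕-Solver.⊜ b) refl
          sum : d₁ +ᵥ d₂ ≡ d +ᵥ (d₁ +ᵥ (d₂ -ᵥ d))
          sum = solve 3 (λ d d₁ d₂ → d₁ :+ d₂ ⊜ d :+ (d₁ :+ (d₂ :- d))) refl d d₁ d₂

      -- For x fixed, d is the fourth vertex of a parallelogram in the fibre over x
      -- whose other three vertices are generic.
      ev-extension : ∀ x d → In x d → ev (extension d) x ≡ φ x d
      ev-extension x d x∈ =
        let d₁ , x∈₁ , fr₁ = fresh-in x d (d ∷ []) (ℕ.s≤s ℕ.z≤n) x∈
            d₂ , x∈₂ , fr₂ = fresh-in x d (d ∷ d₁ ∷ []) (ℕ.s≤s (ℕ.s≤s ℕ.z≤n)) x∈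
        in via x∈₁ x∈₂ (Fresh⇒Gen₁ (Fresh-drop₁ fr₁)) fr₂
        where
          fourth-Gen₁ : ∀ {d₁ d₂} → Fresh d₂ (d ∷ d₁ ∷ []) → Gen₁ (d₁ +ᵥ (d₂ -ᵥ d))
          -- The fresh `d₂` enters with coefficient b, and the minus sign of d is moved into its
          -- coefficient.
          fourth-Gen₁ {d₁} {d₂} fr = Gen₁-intro λ a b null → fr b a (negᵥ b ∷ b ∷ []) (subst Null (begin
            O a +ᵥ D b (d₁ +ᵥ (d₂ -ᵥ d)) ≡⟨ cong (O a +ᵥ_) (trans (D-+ʳ b d₁ (d₂ -ᵥ d)) (cong (D b d₁ +ᵥ_) (Dʳ.f-sub b d₂ d))) ⟩
            O a +ᵥ (D b d₁ +ᵥ (D b d₂ -ᵥ D b d)) ≡⟨ solve 4 (λ o x y z → o :+ (y :+ (z :- x)) ⊜ z :+ (o :+ ((:- x) :+ (y :+ :0)))) refl (O a) (D b d) (D b d₁) (D b d₂) ⟩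
            D b d₂ +ᵥ (O a +ᵥ (negᵥ (D b d) +ᵥ (D b d₁ +ᵥ 0ᵥ))) ≡⟨ cong (λ z → D b d₂ +ᵥ (O a +ᵥ (z +ᵥ (D b d₁ +ᵥ 0ᵥ)))) (sym (Dˡ.f-neg d b)) ⟩
            D b d₂ +ᵥ (O a +ᵥ (D (negᵥ b) d +ᵥ (D b d₁ +ᵥ 0ᵥ))) ∎) null)
          via : ∀ {d₁ d₂} → In x d₁ → In x d₂ → Gen₁ d₁ → Fresh d₂ (d ∷ d₁ ∷ []) → ev (extension d) x ≡ φ x d
          via x∈₁ x∈₂ gen₁ fr =
            ev-extension-via x∈ x∈₁ x∈₂ gen₁ gen₂ gen₁₂ gen₃
              (proj₂ (Canonical-exists gen₁)) (proj₂ (Canonical-exists gen₂)) (proj₂ (Canonical-exists gen₃))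
              (proj₂ (Canonical-exists (Gen₂⇒Gen₁-+ gen₁₂)))
            where
              gen₂ = Fresh⇒Gen₁ (Fresh-drop₁ (Fresh-drop₁ fr))
              gen₁₂ = Fresh⇒Gen₂ gen₁ (Fresh-drop₁ fr)
              gen₃ = fourth-Gen₁ fr

  -- Combinations of the matrices of a bi-affine map, applied to a vector.

  module CombT (n : ℕ) (y : G p n) where

    ap-zero : ∀ m → ap (0M p m n) y ≡ 0ᵥ
    ap-zero zero = refl
    ap-zero (suc m) = cong₂ _∷_ (∙-0ˡ y) (ap-zero m)

    ap-·M : ∀ {m} c (T : Mat p m n) → ap (_·M_ p c T) y ≡ c ·ᵥ ap T y
    ap-·M c [] = refl
    ap-·M c (r ∷ T) = cong₂ _∷_ (∙-·ˡ c r y) (ap-·M c T)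

    ap-step : ∀ {m} c (S T : Mat p m n) {v} → ap T y ≡ v → ap (_+M_ p (_·M_ p c S) T) y ≡ c ·ᵥ ap S y +ᵥ v
    ap-step c S T eq = trans (ap-zipWith (_·M_ p c S) T y) (cong₂ _+ᵥ_ (ap-·M c S) eq)

    -- combT is computed by a function local to its where block, which cannot be named here. The underscore in the
    -- type of ap-combT-go stands for that function: after the with-abstraction in ap-combT its arguments are
    -- distinct variables, so unification finds it.
    CombinesTo : (∀ {k j} → Vec 𝔽 k → BiAffine p n k → Vec 𝔽 j → Vec (Mat p n n) j → Mat p n n) → Set
    CombinesTo h = ∀ {k j} (u : Vec 𝔽 k) (β : BiAffine p n k) (c : Vec 𝔽 j) Ts →
      ap (h u β c Ts) y ≡ lc c (map (λ T → ap T y) Ts)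

    ap-combT : ∀ {k} (u : Vec 𝔽 k) (β : BiAffine p n k) →
      ap (combT p u β) y ≡ lc u (map (λ T → ap T y) (BiAffine.Ts β))
    ap-combT-go : CombinesTo _

    ap-combT [] (biAffine [] as bs l) = ap-zero n
    ap-combT {suc k} (c ∷ u) (biAffine (T ∷ Ts) as bs l)
      with suc k | c ∷ u | biAffine (T ∷ Ts) as bs l
    ... | k′ | u′ | β′ = ap-step c T _ (ap-combT-go u′ β′ u Ts)

    ap-combT-go u β [] [] = ap-zero n
    ap-combT-go u β (c ∷ cs) (T ∷ Ts) = ap-step c T _ (ap-combT-go u β cs Ts)

  -- Existence of generic points by counting.

  module Genericity where

    search-Vec : ∀ {m k} {P Q : Vec (G p k) m → Set} → (∀ x → P x ⊎ Q x) → ∃ P ⊎ (∀ x → Q x)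
    search-Vec {zero} d with d []
    ... | inj₁ h = inj₁ ([] , h)
    ... | inj₂ h = inj₂ λ { [] → h }
    search-Vec {suc m} d with search (λ a → search-Vec (λ x → d (a ∷ x)))
    ... | inj₁ (a , x , h) = inj₁ (a ∷ x , h)
    ... | inj₂ h = inj₂ λ { (a ∷ x) → h a x }

    concat-injective : ∀ {m k} (xs ys : Vec (G p k) m) → concat xs ≡ concat ys → xs ≡ ys
    concat-injective [] [] eq = refl
    concat-injective (x ∷ xs) (y ∷ ys) eq =
      let x≡y , eq′ = ++-injective x y eq in cong₂ _∷_ x≡y (concat-injective xs ys eq′)

    lc-· : ∀ {r n} s (c : Vec 𝔽 r) (vs : Vec (G p n) r) → lc (s ·ᵥ c) vs ≡ s ·ᵥ lc c vs
    lc-· s c vs = ∙-ext λ x → begin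
      lc (s ·ᵥ c) vs ∙ x ≡⟨ lc-∙ (s ·ᵥ c) vs x ⟩
      (s ·ᵥ c) ∙ ap vs x ≡⟨ ∙-·ˡ s c (ap vs x) ⟩
      s ⊛ (c ∙ ap vs x) ≡⟨ cong (s ⊛_) (sym (lc-∙ c vs x)) ⟩
      s ⊛ (lc c vs ∙ x) ≡⟨ sym (∙-·ˡ s (lc c vs) x) ⟩
      (s ·ᵥ lc c vs) ∙ x ∎

    lc-images : ∀ {m n r} (T : Mat p m n) (c : Vec 𝔽 r) Z → lc c (map (ap T) Z) ≡ ap T (lc c Z)
    lc-images T c Z = lc-map (ap T) (ap-+ T) (ap-· T) c Z

    Independent-cons : ∀ {r n} (v : G p n) (vs : Vec (G p n) r) →
      (∀ c → v ≢ lc c vs) → LinIndep p vs → LinIndep p (v ∷ vs)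
    Independent-cons v vs v∉ indep (a ∷ c) eq with a Fin.≟ 0𝔽
    ... | yes refl = cong (0𝔽 ∷_) (indep c (trans (sym (trans (cong (_+ᵥ lc c vs) (·-zero v)) (𝔾.identityˡ (lc c vs)))) eq))
    ... | no a≢0 = contradiction v-in-span (v∉ (a⁻¹ ·ᵥ negᵥ c))
      where
        a⁻¹ = proj₁ (⊛-inverse a a≢0)
        ·-1 : ∀ {n} (u : G p n) → 1𝔽 ·ᵥ u ≡ u
        ·-1 [] = refl
        ·-1 (b ∷ u) = cong₂ _∷_ (⊛-identityˡ b) (·-1 u)
        v-in-span : v ≡ lc (a⁻¹ ·ᵥ negᵥ c) vs
        v-in-span = begin
          v ≡⟨ sym (·-1 v) ⟩
          1𝔽 ·ᵥ v ≡⟨ cong (_·ᵥ v) (sym (proj₂ (⊛-inverse a a≢0))) ⟩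
          (a⁻¹ ⊛ a) ·ᵥ v ≡⟨ ·-assoc a⁻¹ a v ⟩
          a⁻¹ ·ᵥ (a ·ᵥ v) ≡⟨ cong (a⁻¹ ·ᵥ_) (𝔾ₚ.inverseˡ-unique (a ·ᵥ v) (lc c vs) eq) ⟩
          a⁻¹ ·ᵥ negᵥ (lc c vs) ≡⟨ cong (a⁻¹ ·ᵥ_) (sym (lc-left.f-neg vs c)) ⟩
          a⁻¹ ·ᵥ lc (negᵥ c) vs ≡⟨ sym (lc-· a⁻¹ (negᵥ c) vs) ⟩
          lc (a⁻¹ ·ᵥ negᵥ c) vs ∎

    -- Greedy choice. If the images chosen so far, fewer than t of them, already spanned the image
    -- of T, they would be a basis witnessing a rank below t.
    independent-images : ∀ {m n} (T : Mat p m n) t → (∀ r → HasRank p T r → t ℕ.≤ r) →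
      ∀ r → r ℕ.≤ t → ∃ λ (Z : Vec (G p n) r) → LinIndep p (map (ap T) Z)
    independent-images T t rank zero _ = [] , λ { [] _ → refl }
    independent-images T t rank (suc r) r<t
      with independent-images T t rank r (ℕₚ.<⇒≤ r<t)
    ... | Z , indep
      with search {P = λ y → ∀ c → ap T y ≢ lc c (map (ap T) Z)} {Q = λ y → ∃ λ c → ap T y ≡ lc c (map (ap T) Z)}
             (λ y → Sum.swap (search (λ c → ap T y ≟ᵥ lc c (map (ap T) Z))))
    ... | inj₁ (y , y∉) = y ∷ Z , Independent-cons (ap T y) (map (ap T) Z) y∉ indep
    ... | inj₂ spans = contradiction (rank r (map (ap T) Z , indep , spans , λ c → lc c Z , sym (lc-images T c Z))) (ℕₚ.<⇒≱ r<t)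

    -- A bad point e comes with some b ≢ 0 and q such that T_b e = - R q. Adding to e any combination of t vectors with
    -- independent images under T_b loses no information, which is impossible if t exceeds the number of parameters.
    generic-exists : ∀ {n k l m t} (β : BiAffine p n k) →
      (∀ u → NonZeroVec p u → ∀ r → HasRank p (combT p u β) r → t ℕ.≤ r) →
      l ℕ.+ (k ℕ.+ m ℕ.* k) ℕ.< t →
      (E : G p n → G p l) → (∀ a b y → E a ≡ E b → E (y +ᵥ (a -ᵥ b)) ≡ E y) → (y₀ : G p n) →
      (R : Vec (G p k) m → G p n) →
      ∃ λ e → E e ≡ E y₀ × (∀ b q → ap (combT p b β) e +ᵥ R q ≡ 0ᵥ → b ≡ 0ᵥ)
    generic-exists {n} {k} {l} {m} {t} β rank t-large E E-translate y₀ R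
      with search {P = λ e → E e ≡ E y₀ × (∀ b q → ap (combT p b β) e +ᵥ R q ≡ 0ᵥ → b ≡ 0ᵥ)}
                  {Q = λ e → E e ≡ E y₀ → ∃ λ b → ∃ λ q → b ≢ 0ᵥ × ap (combT p b β) e +ᵥ R q ≡ 0ᵥ}
                  classify
      where
        classify : ∀ e → (E e ≡ E y₀ × (∀ b q → ap (combT p b β) e +ᵥ R q ≡ 0ᵥ → b ≡ 0ᵥ)) ⊎
          (E e ≡ E y₀ → ∃ λ b → ∃ λ q → b ≢ 0ᵥ × ap (combT p b β) e +ᵥ R q ≡ 0ᵥ)
        classify e with E e ≟ᵥ E y₀
        ... | inj₂ e∉ = inj₂ λ e∈ → contradiction e∈ e∉
        ... | inj₁ e∈ with search (λ b → search-Vec {m} (λ q → test b q))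
          where
            test : ∀ b q → (b ≢ 0ᵥ × ap (combT p b β) e +ᵥ R q ≡ 0ᵥ) ⊎ (ap (combT p b β) e +ᵥ R q ≡ 0ᵥ → b ≡ 0ᵥ)
            test b q with b ≟ᵥ 0ᵥ | (ap (combT p b β) e +ᵥ R q) ≟ᵥ 0ᵥ
            ... | inj₁ b≡0 | _ = inj₂ λ _ → b≡0
            ... | inj₂ b≢0 | inj₁ eq = inj₁ (b≢0 , eq)
            ... | inj₂ b≢0 | inj₂ neq = inj₂ λ eq → contradiction eq neq
        ...   | inj₁ (b , q , h) = inj₂ λ _ → b , q , h
        ...   | inj₂ h = inj₁ (e∈ , h)
    ... | inj₁ good = good
    ... | inj₂ bad = contradiction (injection⇒≤ encode encode-injective) (ℕₚ.<⇒≱ too-many)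
      where
        find : ∀ s → (∃ λ e → E e ≡ s) ⊎ (∀ e → E e ≢ s)
        find s = search (λ e → E e ≟ᵥ s)

        rep : G p l → G p n
        rep s with find s
        ... | inj₁ (e , _) = e
        -- Default for values that `E` does not take; `rep` is only applied to values of `E`.
        ... | inj₂ _ = y₀

        E-rep : ∀ e → E (rep (E e)) ≡ E e
        E-rep e with find (E e)
        ... | inj₁ (_ , eq) = eq
        ... | inj₂ neq = contradiction refl (neq e)

        π : G p n → G p n
        -- Badness is known only on the level set of `y₀`, so every e is translated into it; the
        -- translation can be undone once `E e` is known.
        π e = y₀ +ᵥ (e -ᵥ rep (E e))

        E-π : ∀ e → E (π e) ≡ E y₀
        E-π e = E-translate e (rep (E e)) y₀ (sym (E-rep e))

        π-injective : ∀ e e′ → E e ≡ E e′ → π e ≡ π e′ → e ≡ e′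
        π-injective e e′ Ee π≡ = begin
          e ≡⟨ solve 3 (λ y e r → e ⊜ (:- y :+ (y :+ (e :- r))) :+ r) refl y₀ e (rep (E e)) ⟩
          (negᵥ y₀ +ᵥ π e) +ᵥ rep (E e) ≡⟨ cong₂ (λ a b → (negᵥ y₀ +ᵥ a) +ᵥ rep b) π≡ Ee ⟩
          (negᵥ y₀ +ᵥ π e′) +ᵥ rep (E e′) ≡⟨ solve 3 (λ y e r → (:- y :+ (y :+ (e :- r))) :+ r ⊜ e) refl y₀ e′ (rep (E e′)) ⟩
          e′ ∎
          where open +ᵥ-Solver

        B : G p n → G p k
        B e = proj₁ (bad (π e) (E-π e))

        Q : G p n → Vec (G p k) m
        Q e = proj₁ (proj₂ (bad (π e) (E-π e)))

        B≢0 : ∀ e → B e ≢ 0ᵥ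
        B≢0 e = proj₁ (proj₂ (proj₂ (bad (π e) (E-π e))))

        bad-eq : ∀ e → ap (combT p (B e) β) (π e) +ᵥ R (Q e) ≡ 0ᵥ
        bad-eq e = proj₂ (proj₂ (proj₂ (bad (π e) (E-π e))))

        Z : G p k → Vec (G p n) t
        Z b with b ≟ᵥ 0ᵥ
        -- Placeholder for b = 0; the coefficient of a bad point is never 0.
        ... | inj₁ _ = replicate t 0ᵥ
        ... | inj₂ b≢0 = proj₁ (independent-images (combT p b β) t (rank b b≢0) t ℕₚ.≤-refl)

        Z-independent : ∀ b → b ≢ 0ᵥ → LinIndep p (map (ap (combT p b β)) (Z b))
        Z-independent b b≢0 with b ≟ᵥ 0ᵥ
        ... | inj₁ b≡0 = contradiction b≡0 b≢0
        ... | inj₂ b≢0 = proj₂ (independent-images (combT p b β) t (rank b b≢0) t ℕₚ.≤-refl)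

        encode : G p (n ℕ.+ t) → G p (l ℕ.+ ((k ℕ.+ m ℕ.* k) ℕ.+ n))
        -- The n + t input coordinates become l + k + m k + n: `E e` undoes the translation, `B e`
        -- and `Q e` determine the matrix and its value at `π e`, and the last block carries `π e`
        -- together with t free coordinates.
        encode v = E e ++ ((B e ++ concat (Q e)) ++ (π e +ᵥ lc (drop n v) (Z (B e))))
          where e = take n v

        too-many : l ℕ.+ ((k ℕ.+ m ℕ.* k) ℕ.+ n) ℕ.< n ℕ.+ t
        too-many = subst₂ ℕ._<_ (ℕₚ.+-assoc l (k ℕ.+ m ℕ.* k) n) (ℕₚ.+-comm t n) (ℕₚ.+-monoˡ-< n t-large)

        -- T_b determines π e, hence also c, from π e + lc c (Z b).
        separate : ∀ b q a a′ c c′ → b ≢ 0ᵥ →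
          ap (combT p b β) a +ᵥ R q ≡ 0ᵥ → ap (combT p b β) a′ +ᵥ R q ≡ 0ᵥ →
          a +ᵥ lc c (Z b) ≡ a′ +ᵥ lc c′ (Z b) → a ≡ a′ × c ≡ c′
        separate b q a a′ c c′ b≢0 eq eq′ same =
          𝔾ₚ.∙-cancelʳ (lc c (Z b)) a a′ (trans same (cong (λ c → a′ +ᵥ lc c (Z b)) (sym c≡c′))) , c≡c′
          where
            T = combT p b β
            Ta≡Ta′ : ap T a ≡ ap T a′
            Ta≡Ta′ = 𝔾ₚ.∙-cancelʳ (R q) (ap T a) (ap T a′) (trans eq (sym eq′))
            images : lc c (map (ap T) (Z b)) ≡ lc c′ (map (ap T) (Z b))
            images = trans (lc-images T c (Z b)) (trans
              (𝔾ₚ.∙-cancelˡ (ap T a) (ap T (lc c (Z b))) (ap T (lc c′ (Z b))) (begin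
                ap T a +ᵥ ap T (lc c (Z b)) ≡⟨ sym (ap-+ T a (lc c (Z b))) ⟩
                ap T (a +ᵥ lc c (Z b)) ≡⟨ cong (ap T) same ⟩
                ap T (a′ +ᵥ lc c′ (Z b)) ≡⟨ ap-+ T a′ (lc c′ (Z b)) ⟩
                ap T a′ +ᵥ ap T (lc c′ (Z b)) ≡⟨ cong (_+ᵥ ap T (lc c′ (Z b))) (sym Ta≡Ta′) ⟩
                ap T a +ᵥ ap T (lc c′ (Z b)) ∎))
              (sym (lc-images T c′ (Z b))))
            c≡c′ : c ≡ c′
            c≡c′ = 𝔾ₚ.x∙y⁻¹≈ε⇒x≈y c c′ (Z-independent b b≢0 (c -ᵥ c′)
              (trans (lc-left.f-sub (map (ap T) (Z b)) c c′)
                (trans (cong (_-ᵥ lc c′ (map (ap T) (Z b))) images) (𝔾.inverseʳ _))))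

        decode : ∀ b b′ q q′ a a′ c c′ → b ≢ 0ᵥ → b ≡ b′ → q ≡ q′ →
          ap (combT p b β) a +ᵥ R q ≡ 0ᵥ → ap (combT p b′ β) a′ +ᵥ R q′ ≡ 0ᵥ →
          a +ᵥ lc c (Z b) ≡ a′ +ᵥ lc c′ (Z b′) → a ≡ a′ × c ≡ c′
        decode b .b q .q a a′ c c′ b≢0 refl refl = separate b q a a′ c c′ b≢0

        encode-injective : ∀ v v′ → encode v ≡ encode v′ → v ≡ v′
        encode-injective v v′ eq =
          let e = take n v
              e′ = take n v′
              Ee , eq₁ = ++-injective (E e) (E e′) eq
              BQ , eq₂ = ++-injective (B e ++ concat (Q e)) (B e′ ++ concat (Q e′)) eq₁
              Be , Qe = ++-injective (B e) (B e′) BQ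
              π≡ , c≡ = decode (B e) (B e′) (Q e) (Q e′) (π e) (π e′) (drop n v) (drop n v′) (B≢0 e)
                          Be (concat-injective (Q e) (Q e′) Qe) (bad-eq e) (bad-eq e′) eq₂
          in begin
            v ≡⟨ sym (take++drop≡id n v) ⟩
            take n v ++ drop n v ≡⟨ cong₂ _++_ (π-injective e e′ Ee π≡) c≡ ⟩
            take n v′ ++ drop n v′ ≡⟨ take++drop≡id n v′ ⟩
            v′ ∎

  -- The Bohr set satisfies the hypotheses of the gluing argument.

  module Bohr
    {n k t : ℕ} (β : BiAffine p n k) (z : Vec 𝔽 k)
    (1≤k : 1 ℕ.≤ k) (t-large : 20 ℕ.* k ℕ.≤ t)
    (rank : ∀ u → NonZeroVec p u → ∀ r → HasRank p (combT p u β) r → t ℕ.≤ r)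
    where

    open Genericity
    open BiAffine β

    lookup-ext : ∀ {A : Set} {m} {u v : Vec A m} → (∀ i → lookup u i ≡ lookup v i) → u ≡ v
    lookup-ext {u = u} {v} h = trans (sym (tabulate∘lookup u)) (trans (tabulate-cong h) (tabulate∘lookup v))

    -- Affine functions x ↦ c + a ∙ x are encoded as vectors c ∷ a, to be paired with 1 ∷ x.
    ev : G p (suc n) → G p n → 𝔽
    ev f x = f ∙ (1𝔽 ∷ x)

    -- Row i encodes the affine function of x given by the i-th coordinate of `β` at (x, y) minus
    -- that of z, so the fibre at y is the common zero set of the rows.
    rows : G p n → Vec (G p (suc n)) k
    rows y = tabulate λ i → ((lookup bs i ∙ y ⊕ lookup lam i) ⊖ lookup z i) ∷ (ap (lookup Ts i) y +ᵥ lookup as i)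

    -- The increment of `rows` when d is added to y; the terms independent of y cancel, which makes
    -- it linear in d.
    rowsD : G p n → Vec (G p (suc n)) k
    rowsD d = tabulate λ i → (lookup bs i ∙ d) ∷ ap (lookup Ts i) d

    ap-rows : ∀ x y → ap (rows y) (1𝔽 ∷ x) ≡ evalβ p β x y -ᵥ z
    ap-rows x y = lookup-ext λ i → begin
      lookup (ap (rows y) (1𝔽 ∷ x)) i ≡⟨ lookup-map i (_∙ (1𝔽 ∷ x)) (rows y) ⟩
      lookup (rows y) i ∙ (1𝔽 ∷ x) ≡⟨ cong (_∙ (1𝔽 ∷ x)) (lookup∘tabulate _ i) ⟩
      ((lookup bs i ∙ y ⊕ lookup lam i) ⊖ lookup z i) ⊛ 1𝔽 ⊕ (ap (lookup Ts i) y +ᵥ lookup as i) ∙ x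
        ≡⟨ cong₂ _⊕_ (⊛-identityʳ _) (trans (∙-+ˡ (ap (lookup Ts i) y) (lookup as i) x) (cong₂ _⊕_ (∙-comm _ x) (∙-comm (lookup as i) x))) ⟩
      ((lookup bs i ∙ y ⊕ lookup lam i) ⊖ lookup z i) ⊕ (x ∙ ap (lookup Ts i) y ⊕ x ∙ lookup as i)
        ≡⟨ rearrange (lookup bs i ∙ y) (lookup lam i) (lookup z i) (x ∙ ap (lookup Ts i) y) (x ∙ lookup as i) ⟩
      (((x ∙ ap (lookup Ts i) y ⊕ x ∙ lookup as i) ⊕ lookup bs i ∙ y) ⊕ lookup lam i) ⊖ lookup z i
        ≡⟨ sym (trans (lookup-zipWith _⊕_ i (evalβ p β x y) (negᵥ z)) (cong₂ _⊕_ (lookup∘tabulate _ i) (lookup-map i neg𝔽 z))) ⟩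
      lookup (evalβ p β x y -ᵥ z) i ∎
      where
        open ⊕-Solver
        rearrange : ∀ b l z t a → ((b ⊕ l) ⊖ z) ⊕ (t ⊕ a) ≡ (((t ⊕ a) ⊕ b) ⊕ l) ⊖ z
        rearrange = solve 5 (λ b l z t a → ((b :+ l) :- z) :+ (t :+ a) ⊜ (((t :+ a) :+ b) :+ l) :- z) refl

    InBohr⇒rows : ∀ {x y} → InBohr p β z x y → ap (rows y) (1𝔽 ∷ x) ≡ 0ᵥ
    InBohr⇒rows {x} {y} h = trans (ap-rows x y) (trans (cong (_-ᵥ z) h) (𝔾.inverseʳ z))

    rows⇒InBohr : ∀ {x y} → ap (rows y) (1𝔽 ∷ x) ≡ 0ᵥ → InBohr p β z x y
    rows⇒InBohr {x} {y} h = 𝔾ₚ.x∙y⁻¹≈ε⇒x≈y (evalβ p β x y) z (trans (sym (ap-rows x y)) h)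

    rows-+ : ∀ y d → rows (y +ᵥ d) ≡ zipWith _+ᵥ_ (rows y) (rowsD d)
    rows-+ y d = lookup-ext λ i → begin
      lookup (rows (y +ᵥ d)) i ≡⟨ lookup∘tabulate _ i ⟩
      _ ≡⟨ cong₂ _∷_
             (trans (cong (λ s → (s ⊕ lookup lam i) ⊖ lookup z i) (∙-+ʳ (lookup bs i) y d))
               (⊕-Solver.solve 4 (λ s t l z → ((s ⊕-Solver.:+ t) ⊕-Solver.:+ l) ⊕-Solver.:- z ⊕-Solver.⊜ ((s ⊕-Solver.:+ l) ⊕-Solver.:- z) ⊕-Solver.:+ t)
                 refl (lookup bs i ∙ y) (lookup bs i ∙ d) (lookup lam i) (lookup z i)))
             (trans (cong (_+ᵥ lookup as i) (ap-+ (lookup Ts i) y d))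
               (+ᵥ-Solver.solve 3 (λ s t a → (s +ᵥ-Solver.:+ t) +ᵥ-Solver.:+ a +ᵥ-Solver.⊜ (s +ᵥ-Solver.:+ a) +ᵥ-Solver.:+ t)
                 refl (ap (lookup Ts i) y) (ap (lookup Ts i) d) (lookup as i))) ⟩
      _ ≡⟨ sym (cong₂ _+ᵥ_ (lookup∘tabulate _ i) (lookup∘tabulate _ i)) ⟩
      lookup (rows y) i +ᵥ lookup (rowsD d) i ≡⟨ sym (lookup-zipWith _+ᵥ_ i (rows y) (rowsD d)) ⟩
      lookup (zipWith _+ᵥ_ (rows y) (rowsD d)) i ∎

    rowsD-+ : ∀ d e → rowsD (d +ᵥ e) ≡ zipWith _+ᵥ_ (rowsD d) (rowsD e)
    rowsD-+ d e = lookup-ext λ i → begin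
      lookup (rowsD (d +ᵥ e)) i ≡⟨ lookup∘tabulate _ i ⟩
      _ ≡⟨ cong₂ _∷_ (∙-+ʳ (lookup bs i) d e) (ap-+ (lookup Ts i) d e) ⟩
      _ ≡⟨ sym (cong₂ _+ᵥ_ (lookup∘tabulate _ i) (lookup∘tabulate _ i)) ⟩
      lookup (rowsD d) i +ᵥ lookup (rowsD e) i ≡⟨ sym (lookup-zipWith _+ᵥ_ i (rowsD d) (rowsD e)) ⟩
      lookup (zipWith _+ᵥ_ (rowsD d) (rowsD e)) i ∎

    D : G p k → G p n → G p (suc n)
    D c d = lc c (rowsD d)

    D-+ʳ : ∀ c d e → D c (d +ᵥ e) ≡ D c d +ᵥ D c e
    D-+ʳ c d e = trans (cong (lc c) (rowsD-+ d e)) (lc-+ʳ c (rowsD d) (rowsD e))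

    tail-D : ∀ c d → tail (D c d) ≡ ap (combT p c β) d
    tail-D c d = begin
      tail (lc c (rowsD d)) ≡⟨ tail-lc c (rowsD d) ⟩
      lc c (map tail (rowsD d)) ≡⟨ cong (lc c) (sym (tabulate-∘ tail _)) ⟩
      lc c (tabulate (λ i → ap (lookup Ts i) d)) ≡⟨ cong (lc c) (tabulate-∘ (λ T → ap T d) (lookup Ts)) ⟩
      lc c (map (λ T → ap T d) (tabulate (lookup Ts))) ≡⟨ cong (λ Ts → lc c (map (λ T → ap T d) Ts)) (tabulate∘lookup Ts) ⟩
      lc c (map (λ T → ap T d) Ts) ≡⟨ sym (CombT.ap-combT n d c β) ⟩
      ap (combT p c β) d ∎

    tail-rows : ∀ c y → tail (lc c (rows y)) ≡ ap (combT p c β) y +ᵥ lc c as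
    tail-rows c y = begin
      tail (lc c (rows y)) ≡⟨ tail-lc c (rows y) ⟩
      lc c (map tail (rows y)) ≡⟨ cong (lc c) (lookup-ext same) ⟩
      lc c (zipWith _+ᵥ_ (map (λ T → ap T y) Ts) as) ≡⟨ lc-+ʳ c _ as ⟩
      lc c (map (λ T → ap T y) Ts) +ᵥ lc c as ≡⟨ cong (_+ᵥ lc c as) (sym (CombT.ap-combT n y c β)) ⟩
      ap (combT p c β) y +ᵥ lc c as ∎
      where
        same : ∀ i → lookup (map tail (rows y)) i ≡ lookup (zipWith _+ᵥ_ (map (λ T → ap T y) Ts) as) i
        same i = trans (lookup-map i tail (rows y)) (trans (cong tail (lookup∘tabulate _ i)) (sym
          (trans (lookup-zipWith _+ᵥ_ i (map (λ T → ap T y) Ts) as) (cong (_+ᵥ lookup as i) (lookup-map i (λ T → ap T y) Ts)))))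

    tail-+ : ∀ (u w : G p (suc n)) → tail (u +ᵥ w) ≡ tail u +ᵥ tail w
    tail-+ (_ ∷ _) (_ ∷ _) = refl

    -- At most k coordinates for a fibre condition, k for the coefficient of the new point, and 4k
    -- for the other coefficients: one block for `O` and up to three for earlier points. That is 6k
    -- in all, and 6k < 20k because k is positive.
    parameters-bound : ∀ {l m} → l ℕ.≤ k → m ℕ.≤ 4 → l ℕ.+ (k ℕ.+ m ℕ.* k) ℕ.< t
    parameters-bound {l} {m} l≤k m≤4 = ℕₚ.<-≤-trans (ℕₚ.≤-<-trans
        (ℕₚ.+-mono-≤ l≤k (ℕₚ.+-monoʳ-≤ k (ℕₚ.*-monoˡ-≤ k m≤4)))
        (ℕₚ.*-monoˡ-< k {{ℕ.>-nonZero 1≤k}} {6} {20} (ℕₚ.≤ᵇ⇒≤ 7 20 _))) t-large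

    base : ∃ λ o → ∀ c → tail (lc c (rows o)) ≡ 0ᵥ → c ≡ 0ᵥ
    -- The linear part of `lc c (rows o)` is `combT p c β` applied to o plus `lc c as`. Letting the
    -- coefficients q of `as` vary independently of c fits `generic-exists`; the case q = c is what
    -- is used.
    base with generic-exists {l = 0} {m = 1} β rank (parameters-bound ℕ.z≤n (ℕ.s≤s ℕ.z≤n)) (λ _ → []) (λ _ _ _ _ → refl) 0ᵥ (λ { (q ∷ []) → lc q as })
    ... | o , _ , h = o , λ c eq → h c (c ∷ []) (trans (sym (tail-rows c o)) eq)

    o : G p n
    o = proj₁ base

    O : G p k → G p (suc n)
    O c = lc c (rows o)

    In : G p n → G p n → Set
    In x d = ap (rows (o +ᵥ d)) (1𝔽 ∷ x) ≡ 0ᵥ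

    ap-rows-o : ∀ x d → ap (rows (o +ᵥ d)) x ≡ ap (rows o) x +ᵥ ap (rowsD d) x
    ap-rows-o x d = trans (cong (λ T → ap T x) (rows-+ o d)) (ap-zipWith (rows o) (rowsD d) x)

    module ap-rowsD x = AdditiveMap +ᵥ-isAbelianGroup +ᵥ-isAbelianGroup (λ d → ap (rowsD d) x)
      (λ d e → trans (cong (λ T → ap T x) (rowsD-+ d e)) (ap-zipWith (rowsD d) (rowsD e) x))

    ap-rows-translate : ∀ x a b c → ap (rows (o +ᵥ (b +ᵥ (c -ᵥ a)))) x ≡
      ap (rows (o +ᵥ b)) x +ᵥ (ap (rows (o +ᵥ c)) x -ᵥ ap (rows (o +ᵥ a)) x)
    ap-rows-translate x a b c = begin
      ap (rows (o +ᵥ (b +ᵥ (c -ᵥ a)))) x ≡⟨ ap-rows-o x (b +ᵥ (c -ᵥ a)) ⟩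
      A +ᵥ E (b +ᵥ (c -ᵥ a)) ≡⟨ cong (A +ᵥ_) (trans (trans (cong (λ T → ap T x) (rowsD-+ b (c -ᵥ a))) (ap-zipWith (rowsD b) (rowsD (c -ᵥ a)) x))
                                  (cong (E b +ᵥ_) (ap-rowsD.f-sub x c a))) ⟩
      A +ᵥ (E b +ᵥ (E c -ᵥ E a)) ≡⟨ solve 4 (λ o a b c → o :+ (b :+ (c :- a)) ⊜ (o :+ b) :+ ((o :+ c) :- (o :+ a))) refl A (E a) (E b) (E c) ⟩
      (A +ᵥ E b) +ᵥ ((A +ᵥ E c) -ᵥ (A +ᵥ E a)) ≡⟨ sym (cong₂ _+ᵥ_ (ap-rows-o x b) (cong₂ _-ᵥ_ (ap-rows-o x c) (ap-rows-o x a))) ⟩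
      _ ∎
      where
        open +ᵥ-Solver
        A = ap (rows o) x
        E = λ d → ap (rowsD d) x

    In-parallelogram : ∀ {x a b c} → In x a → In x b → In x c → In x (b +ᵥ (c -ᵥ a))
    In-parallelogram {x} {a} {b} {c} ha hb hc =
      trans (ap-rows-translate (1𝔽 ∷ x) a b c) (trans (cong₂ _+ᵥ_ hb (cong₂ _-ᵥ_ hc ha)) (trans (𝔾.identityˡ _) (𝔾.inverseʳ 0ᵥ)))

    S-rows : ∀ c d → O c +ᵥ D c d ≡ lc c (rows (o +ᵥ d))
    S-rows c d = sym (trans (cong (lc c) (rows-+ o d)) (lc-+ʳ c (rows o) (rowsD d)))

    ev-vanishes : ∀ {x d} c → In x d → ev (O c +ᵥ D c d) x ≡ 0𝔽
    ev-vanishes {x} {d} c h = begin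
      ev (O c +ᵥ D c d) x ≡⟨ cong (λ f → ev f x) (S-rows c d) ⟩
      lc c (rows (o +ᵥ d)) ∙ (1𝔽 ∷ x) ≡⟨ lc-∙ c (rows (o +ᵥ d)) (1𝔽 ∷ x) ⟩
      c ∙ ap (rows (o +ᵥ d)) (1𝔽 ∷ x) ≡⟨ cong (c ∙_) h ⟩
      c ∙ 0ᵥ ≡⟨ ∙-0ʳ c ⟩
      0𝔽 ∎

    -- The points `1𝔽 ∷ x` form the hyperplane where the functional `1𝔽 ∷ 0ᵥ`, which encodes the
    -- constant function 1, equals 1. Independence of the tails makes `vs` independent together with
    -- this functional, as `vanishing⇒lc` requires.
    ev-vanishing⇒lc : ∀ {r} (vs : Vec (G p (suc n)) r) (h : G p (suc n)) → (∀ c → tail (lc c vs) ≡ 0ᵥ → c ≡ 0ᵥ) →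
      (∀ x → ap vs (1𝔽 ∷ x) ≡ 0ᵥ → ev h x ≡ 0𝔽) → ∃ λ c → h ≡ lc c vs
    ev-vanishing⇒lc vs h indep vanish = vanishing⇒lc (1𝔽 ∷ 0ᵥ) vs indep′ h vanish′
      where
        vanish′ : ∀ x → (1𝔽 ∷ 0ᵥ) ∙ x ≡ 1𝔽 → ap vs x ≡ 0ᵥ → h ∙ x ≡ 0𝔽
        vanish′ (a ∷ x) head≡1 with trans (sym (trans (cong₂ _⊕_ (⊛-identityˡ a) (∙-0ˡ x)) (⊕-identityʳ a))) head≡1
        ... | refl = vanish x
        indep′ : LinIndep p ((1𝔽 ∷ 0ᵥ) ∷ vs)
        indep′ (a ∷ c) eq = cong₂ _∷_ a≡0 c≡0
          where
            scaled : a ·ᵥ (1𝔽 ∷ 0ᵥ) ≡ a ∷ 0ᵥ {n}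
            scaled = cong₂ _∷_ (⊛-identityʳ a) (·-right.f-0 a)
            c≡0 : c ≡ 0ᵥ
            c≡0 = indep c (begin
              tail (lc c vs) ≡⟨ sym (𝔾.identityˡ _) ⟩
              0ᵥ +ᵥ tail (lc c vs) ≡⟨ sym (tail-+ (a ∷ 0ᵥ) (lc c vs)) ⟩
              tail ((a ∷ 0ᵥ) +ᵥ lc c vs) ≡⟨ cong tail (trans (cong (_+ᵥ lc c vs) (sym scaled)) eq) ⟩
              0ᵥ ∎)
            a≡0 : a ≡ 0𝔽
            a≡0 = proj₁ (∷-injective (begin
              a ∷ 0ᵥ ≡⟨ sym scaled ⟩
              a ·ᵥ (1𝔽 ∷ 0ᵥ) ≡⟨ sym (𝔾.identityʳ _) ⟩
              a ·ᵥ (1𝔽 ∷ 0ᵥ) +ᵥ 0ᵥ ≡⟨ cong (a ·ᵥ (1𝔽 ∷ 0ᵥ) +ᵥ_) (sym (trans (cong (λ c → lc c vs) c≡0) (lc-left.f-0 vs))) ⟩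
              a ·ᵥ (1𝔽 ∷ 0ᵥ) +ᵥ lc c vs ≡⟨ eq ⟩
              0ᵥ ∎))

    Null : G p (suc n) → Set
    Null f = tail f ≡ 0ᵥ

    vanishing₁ : ∀ d h → (∀ a → Null (O a +ᵥ D a d) → a ≡ 0ᵥ) →
      (∀ x → In x d → ev h x ≡ 0𝔽) → ∃ λ a → h ≡ O a +ᵥ D a d
    vanishing₁ d h indep vanish =
      let c , eq = ev-vanishing⇒lc (rows (o +ᵥ d)) h (λ c null → indep c (trans (cong tail (S-rows c d)) null)) vanish
      in c , trans eq (sym (S-rows c d))

    rows₃ : G p n → G p n → G p n → Vec (G p (suc n)) (k ℕ.+ (k ℕ.+ k))
    rows₃ e u v = rows (o +ᵥ e) ++ (rowsD u ++ rowsD v)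

    lc-rows₃ : ∀ e u v a b c → lc (a ++ (b ++ c)) (rows₃ e u v) ≡ (O a +ᵥ D a e) +ᵥ (D b u +ᵥ D c v)
    lc-rows₃ e u v a b c =
      trans (lc-++ a (b ++ c) (rows (o +ᵥ e)) (rowsD u ++ rowsD v))
        (cong₂ _+ᵥ_ (sym (S-rows a e)) (lc-++ b c (rowsD u) (rowsD v)))

    replicate-++ : ∀ {m l} → 0ᵥ {m} ++ 0ᵥ {l} ≡ 0ᵥ
    replicate-++ {zero} = refl
    replicate-++ {suc m} = cong (0𝔽 ∷_) (replicate-++ {m})

    -- If the rows at e and the increments along u and v all vanish at x, then x lies over e, e + u
    -- and e + v. So h vanishes at the common zeros of these 3k functions and is a combination of
    -- them.
    vanishing₃ : ∀ e u v h →
      (∀ a b c → Null ((O a +ᵥ D a e) +ᵥ (D b u +ᵥ D c v)) → a ≡ 0ᵥ × b ≡ 0ᵥ × c ≡ 0ᵥ) →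
      (∀ x → In x e → In x (e +ᵥ u) → In x (e +ᵥ v) → ev h x ≡ 0𝔽) →
      ∃ λ a → ∃ λ b → ∃ λ c → h ≡ (O a +ᵥ D a e) +ᵥ (D b u +ᵥ D c v)
    vanishing₃ e u v h indep vanish =
      let c , eq = ev-vanishing⇒lc (rows₃ e u v) h indep′ vanish′
      in c₁ c , c₂ c , c₃ c , trans eq (split c)
      where
        c₁ c₂ c₃ : G p (k ℕ.+ (k ℕ.+ k)) → G p k
        c₁ c = take k c
        c₂ c = take k (drop k c)
        c₃ c = drop k (drop k c)
        c-split : ∀ c → c₁ c ++ (c₂ c ++ c₃ c) ≡ c
        c-split c = trans (cong (c₁ c ++_) (take++drop≡id k (drop k c))) (take++drop≡id k c)
        split : ∀ c → lc c (rows₃ e u v) ≡ (O (c₁ c) +ᵥ D (c₁ c) e) +ᵥ (D (c₂ c) u +ᵥ D (c₃ c) v)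
        split c = trans (cong (λ c → lc c (rows₃ e u v)) (sym (c-split c))) (lc-rows₃ e u v (c₁ c) (c₂ c) (c₃ c))
        indep′ : ∀ c → tail (lc c (rows₃ e u v)) ≡ 0ᵥ → c ≡ 0ᵥ
        indep′ c null =
          let a≡0 , b≡0 , c≡0 = indep (c₁ c) (c₂ c) (c₃ c) (trans (cong tail (sym (split c))) null)
          in trans (sym (c-split c)) (trans (cong₂ _++_ a≡0 (trans (cong₂ _++_ b≡0 c≡0) (replicate-++ {k} {k}))) (replicate-++ {k} {k ℕ.+ k}))
        In-+ : ∀ x u → In x e → ap (rowsD u) (1𝔽 ∷ x) ≡ 0ᵥ → In x (e +ᵥ u)
        In-+ x u he hu = begin
          ap (rows (o +ᵥ (e +ᵥ u))) (1𝔽 ∷ x) ≡⟨ cong (λ y → ap (rows y) (1𝔽 ∷ x)) (sym (𝔾.assoc o e u)) ⟩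
          ap (rows ((o +ᵥ e) +ᵥ u)) (1𝔽 ∷ x) ≡⟨ trans (cong (λ T → ap T (1𝔽 ∷ x)) (rows-+ (o +ᵥ e) u)) (ap-zipWith (rows (o +ᵥ e)) (rowsD u) (1𝔽 ∷ x)) ⟩
          ap (rows (o +ᵥ e)) (1𝔽 ∷ x) +ᵥ ap (rowsD u) (1𝔽 ∷ x) ≡⟨ cong₂ _+ᵥ_ he hu ⟩
          0ᵥ +ᵥ 0ᵥ ≡⟨ 𝔾.identityˡ 0ᵥ ⟩
          0ᵥ ∎
        vanish′ : ∀ x → ap (rows₃ e u v) (1𝔽 ∷ x) ≡ 0ᵥ → ev h x ≡ 0𝔽
        vanish′ x eq =
          let he , huv = ++-injective (ap (rows (o +ᵥ e)) (1𝔽 ∷ x)) 0ᵥ (trans (sym (map-++ (_∙ (1𝔽 ∷ x)) (rows (o +ᵥ e)) (rowsD u ++ rowsD v)))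
                (trans eq (sym (replicate-++ {k} {k ℕ.+ k}))))
              hu , hv = ++-injective (ap (rowsD u) (1𝔽 ∷ x)) 0ᵥ (trans (sym (map-++ (_∙ (1𝔽 ∷ x)) (rowsD u) (rowsD v)))
                (trans huv (sym (replicate-++ {k} {k}))))
          in vanish x he (In-+ x u he hu) (In-+ x v he hv)

    module Ext = Extension D (λ b c d → lc-+ˡ b c (rowsD d)) D-+ʳ O (λ b c → lc-+ˡ b c (rows o))
      Null (proj₂ base) refl (G p n) ev (λ f g x → ∙-+ˡ f g (1𝔽 ∷ x)) In In-parallelogram ev-vanishes vanishing₁ vanishing₃
    open Ext using (ΣD; Fresh)

    parameters : ∀ {m} → Vec (G p n) m → Vec (G p k) (suc m) → G p n
    parameters ds (a ∷ cs) = tail (O a +ᵥ ΣD cs ds)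

    generic⇒Fresh : ∀ {m e} (ds : Vec (G p n) m) →
      (∀ b q → ap (combT p b β) e +ᵥ parameters ds q ≡ 0ᵥ → b ≡ 0ᵥ) → Fresh e ds
    generic⇒Fresh {e = e} ds h b a cs null = h b (a ∷ cs)
      (trans (trans (cong (_+ᵥ tail (O a +ᵥ ΣD cs ds)) (sym (tail-D b e))) (sym (tail-+ (D b e) (O a +ᵥ ΣD cs ds)))) null)

    fresh : ∀ {m} (ds : Vec (G p n) m) → m ℕ.≤ 3 → ∃ λ e → Fresh e ds
    fresh ds m≤3 =
      let e , _ , h = generic-exists {l = 0} β rank (parameters-bound ℕ.z≤n (ℕ.s≤s m≤3)) (λ _ → []) (λ _ _ _ _ → refl) 0ᵥ (parameters ds)
      in e , generic⇒Fresh ds h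

    -- The fibre over x is a level set of an affine map to k coordinates, so the search for a fresh
    -- point can be confined to it at the cost of k more parameters.
    fresh-in : ∀ {m} x d (ds : Vec (G p n) m) → m ℕ.≤ 3 → In x d → ∃ λ e → In x e × Fresh e ds
    fresh-in x d ds m≤3 x∈ =
      let e , Ee , h = generic-exists β rank (parameters-bound ℕₚ.≤-refl (ℕ.s≤s m≤3)) (λ d → ap (rows (o +ᵥ d)) (1𝔽 ∷ x)) translate d (parameters ds)
      in e , trans Ee x∈ , generic⇒Fresh ds h
      where
        translate : ∀ a b y → ap (rows (o +ᵥ a)) (1𝔽 ∷ x) ≡ ap (rows (o +ᵥ b)) (1𝔽 ∷ x) →
          ap (rows (o +ᵥ (y +ᵥ (a -ᵥ b)))) (1𝔽 ∷ x) ≡ ap (rows (o +ᵥ y)) (1𝔽 ∷ x)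
        translate a b y eq = trans (ap-rows-translate (1𝔽 ∷ x) b y a)
          (trans (cong (λ z → ap (rows (o +ᵥ y)) (1𝔽 ∷ x) +ᵥ (z -ᵥ ap (rows (o +ᵥ b)) (1𝔽 ∷ x))) eq)
            (trans (cong (ap (rows (o +ᵥ y)) (1𝔽 ∷ x) +ᵥ_) (𝔾.inverseʳ _)) (𝔾.identityʳ _)))

    AffineForm : (G p n → Set) → (G p n → 𝔽) → Set
    AffineForm S f = ∃ λ a → ∃ λ c → ∀ x → S x → f x ≡ a ∙ x ⊕ c

    -- Extension of scalar-valued functions.

    module ScalarExtension (φ : G p n → G p n → 𝔽)
      (affine-right : ∀ x → AffineForm (λ y → InBohr p β z x y) (φ x))
      (affine-left : ∀ y → AffineForm (λ x → InBohr p β z x y) (λ x → φ x y))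
      where

      lift₀ : G p n → G p (suc n)
      lift₀ y = proj₁ (proj₂ (affine-left y)) ∷ proj₁ (affine-left y)

      ev-lift₀ : ∀ y x → InBohr p β z x y → ev (lift₀ y) x ≡ φ x y
      ev-lift₀ y x h with affine-left y
      ... | a , c , eq = trans (cong (_⊕ a ∙ x) (⊛-identityʳ c)) (trans (⊕-comm c (a ∙ x)) (sym (eq x h)))

      f₀ : G p (suc n)
      f₀ = lift₀ o

      -- Subtracting one lift at o for every y makes the zero function a lift at d = 0; `ψ` adds it
      -- back.
      φ₀ : G p n → G p n → 𝔽
      φ₀ x d = φ x (o +ᵥ d) ⊖ ev f₀ x

      ev-sub : ∀ f g x → ev (f -ᵥ g) x ≡ ev f x ⊖ ev g x
      ev-sub f g x = ∙-left.f-sub (1𝔽 ∷ x) f g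

      φ₀-0 : ∀ {x} → In x 0ᵥ → φ₀ x 0ᵥ ≡ 0𝔽
      φ₀-0 {x} h = trans (cong (_⊖ ev f₀ x) (trans (cong (φ x) (𝔾.identityʳ o))
        (sym (ev-lift₀ o x (subst (InBohr p β z x) (𝔾.identityʳ o) (rows⇒InBohr h)))))) (⊕-inverseʳ (ev f₀ x))

      lift : ∀ d → ∃ λ f → ∀ x → In x d → ev f x ≡ φ₀ x d
      lift d = lift₀ (o +ᵥ d) -ᵥ f₀ , λ x h →
        trans (ev-sub (lift₀ (o +ᵥ d)) f₀ x) (cong (_⊖ ev f₀ x) (ev-lift₀ (o +ᵥ d) x (rows⇒InBohr h)))

      φ₀-parallelogram : ∀ {x a b c} → In x a → In x b → In x c → φ₀ x (b +ᵥ (c -ᵥ a)) ⊕ φ₀ x a ≡ φ₀ x b ⊕ φ₀ x c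
      φ₀-parallelogram {x} {a} {b} {c} ha hb hc = begin
        φ₀ x (b +ᵥ (c -ᵥ a)) ⊕ φ₀ x a
          ≡⟨ cong₂ (λ s t → (s ⊖ ev f₀ x) ⊕ (t ⊖ ev f₀ x)) (value (b +ᵥ (c -ᵥ a)) (In-parallelogram {x} {a} {b} {c} ha hb hc)) (value a ha) ⟩
        ((α ∙ o ⊕ α ∙ (b +ᵥ (c -ᵥ a)) ⊕ γ) ⊖ ev f₀ x) ⊕ ((α ∙ o ⊕ α ∙ a ⊕ γ) ⊖ ev f₀ x)
          ≡⟨ cong (λ s → ((α ∙ o ⊕ s ⊕ γ) ⊖ ev f₀ x) ⊕ ((α ∙ o ⊕ α ∙ a ⊕ γ) ⊖ ev f₀ x))
               (trans (∙-+ʳ α b (c -ᵥ a)) (cong (α ∙ b ⊕_) (∙-right.f-sub α c a))) ⟩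
        ((α ∙ o ⊕ (α ∙ b ⊕ (α ∙ c ⊖ α ∙ a)) ⊕ γ) ⊖ ev f₀ x) ⊕ ((α ∙ o ⊕ α ∙ a ⊕ γ) ⊖ ev f₀ x)
          ≡⟨ rearrange (α ∙ o) (α ∙ a) (α ∙ b) (α ∙ c) γ (ev f₀ x) ⟩
        ((α ∙ o ⊕ α ∙ b ⊕ γ) ⊖ ev f₀ x) ⊕ ((α ∙ o ⊕ α ∙ c ⊕ γ) ⊖ ev f₀ x)
          ≡⟨ sym (cong₂ (λ s t → (s ⊖ ev f₀ x) ⊕ (t ⊖ ev f₀ x)) (value b hb) (value c hc)) ⟩
        φ₀ x b ⊕ φ₀ x c ∎
        where
          α = proj₁ (affine-right x)
          γ = proj₁ (proj₂ (affine-right x))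
          eq = proj₂ (proj₂ (affine-right x))
          value : ∀ d → In x d → φ x (o +ᵥ d) ≡ α ∙ o ⊕ α ∙ d ⊕ γ
          value d h = trans (eq (o +ᵥ d) (rows⇒InBohr h)) (cong (_⊕ γ) (∙-+ʳ α o d))
          open ⊕-Solver
          rearrange : ∀ o a b c g f → ((o ⊕ (b ⊕ (c ⊖ a)) ⊕ g) ⊖ f) ⊕ ((o ⊕ a ⊕ g) ⊖ f) ≡ ((o ⊕ b ⊕ g) ⊖ f) ⊕ ((o ⊕ c ⊕ g) ⊖ f)
          rearrange = solve 6 (λ o a b c g f → ((o :+ (b :+ (c :- a)) :+ g) :- f) :+ ((o :+ a :+ g) :- f)
            ⊜ ((o :+ b :+ g) :- f) :+ ((o :+ c :+ g) :- f)) refl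

      abstract
        M : G p n → G p (suc n)
        M = Ext.extension fresh fresh-in φ₀ (λ {x} {a} {b} {c} → φ₀-parallelogram {x} {a} {b} {c}) φ₀-0 lift

        M-+ : ∀ d e → M (d +ᵥ e) ≡ M d +ᵥ M e
        M-+ = Ext.extension-+ fresh fresh-in φ₀ (λ {x} {a} {b} {c} → φ₀-parallelogram {x} {a} {b} {c}) φ₀-0 lift

        ev-M : ∀ x d → In x d → ev (M d) x ≡ φ₀ x d
        ev-M = Ext.ev-extension fresh fresh-in φ₀ (λ {x} {a} {b} {c} → φ₀-parallelogram {x} {a} {b} {c}) φ₀-0 lift

      ψ : G p n → G p n → 𝔽
      ψ x y = ev (M (y -ᵥ o) +ᵥ f₀) x

      ψ-extends : ∀ x y → InBohr p β z x y → ψ x y ≡ φ x y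
      ψ-extends x y h = begin
        ev (M (y -ᵥ o) +ᵥ f₀) x ≡⟨ ∙-+ˡ (M (y -ᵥ o)) f₀ (1𝔽 ∷ x) ⟩
        ev (M (y -ᵥ o)) x ⊕ ev f₀ x ≡⟨ cong (_⊕ ev f₀ x) (ev-M x (y -ᵥ o) (trans (cong (λ y → ap (rows y) (1𝔽 ∷ x)) o+y-o) (InBohr⇒rows h))) ⟩
        (φ x (o +ᵥ (y -ᵥ o)) ⊖ ev f₀ x) ⊕ ev f₀ x ≡⟨ ⊕-Solver.solve 2 (λ a b → (a ⊕-Solver.:- b) ⊕-Solver.:+ b ⊕-Solver.⊜ a) refl (φ x (o +ᵥ (y -ᵥ o))) (ev f₀ x) ⟩
        φ x (o +ᵥ (y -ᵥ o)) ≡⟨ cong (φ x) o+y-o ⟩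
        φ x y ∎
        where
          o+y-o : o +ᵥ (y -ᵥ o) ≡ y
          o+y-o = +ᵥ-Solver.solve 2 (λ o y → o +ᵥ-Solver.:+ (y +ᵥ-Solver.:- o) +ᵥ-Solver.⊜ y) refl o y

      ψ-affine-left : ∀ y → ∃ λ a → ∃ λ c → ∀ x → ψ x y ≡ a ∙ x ⊕ c
      ψ-affine-left y with M (y -ᵥ o) +ᵥ f₀
      ... | c ∷ a = a , c , λ x → trans (cong (_⊕ a ∙ x) (⊛-identityʳ c)) (⊕-comm c (a ∙ x))

      ψ-affine-right : ∀ x → ∃ λ a → ∃ λ c → ∀ y → ψ x y ≡ a ∙ y ⊕ c
      -- For fixed x the glued map is additive in d, hence linear, while the restored lift at o
      -- contributes a term constant in y.
      ψ-affine-right x = a , (ev f₀ x ⊖ a ∙ o) , λ y → begin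
        ev (M (y -ᵥ o) +ᵥ f₀) x ≡⟨ ∙-+ˡ (M (y -ᵥ o)) f₀ (1𝔽 ∷ x) ⟩
        ev (M (y -ᵥ o)) x ⊕ ev f₀ x ≡⟨ cong (_⊕ ev f₀ x) (trans (proj₂ linear (y -ᵥ o)) (∙-right.f-sub a y o)) ⟩
        (a ∙ y ⊖ a ∙ o) ⊕ ev f₀ x ≡⟨ solve 3 (λ s t u → (s :- t) :+ u ⊜ s :+ (u :- t)) refl (a ∙ y) (a ∙ o) (ev f₀ x) ⟩
        a ∙ y ⊕ (ev f₀ x ⊖ a ∙ o) ∎
        where
          open ⊕-Solver
          linear = additive⇒linear (λ d → ev (M d) x) (λ d e → trans (cong (λ f → ev f x) (M-+ d e)) (∙-+ˡ (M d) (M e) (1𝔽 ∷ x)))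
          a = proj₁ linear

    -- Vector-valued functions, one coordinate at a time.

    module VectorExtension (φ : G p n → G p n → G p n) (affine : AffineEachVar p (InBohr p β z) φ) where

      lookup-affApp : ∀ (A : Mat p n n) c x i → lookup (affApp p A c x) i ≡ lookup A i ∙ x ⊕ lookup c i
      lookup-affApp A c x i = trans (lookup-zipWith _⊕_ i (ap A x) c) (cong (_⊕ lookup c i) (lookup-map i (_∙ x) A))

      coordinate-affine-right : ∀ i x → AffineForm (λ y → InBohr p β z x y) (λ y → lookup (φ x y) i)
      coordinate-affine-right i x = let A , c , eq = proj₁ affine x in
        lookup A i , lookup c i , λ y h → trans (cong (λ v → lookup v i) (eq y h)) (lookup-affApp A c y i)

      coordinate-affine-left : ∀ i y → AffineForm (λ x → InBohr p β z x y) (λ x → lookup (φ x y) i)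
      coordinate-affine-left i y = let A , c , eq = proj₂ affine y in
        lookup A i , lookup c i , λ x h → trans (cong (λ v → lookup v i) (eq x h)) (lookup-affApp A c x i)

      module Coordinate (i : Fin n) =
        ScalarExtension (λ x y → lookup (φ x y) i) (coordinate-affine-right i) (coordinate-affine-left i)

      ψ : G p n → G p n → G p n
      ψ x y = tabulate λ i → Coordinate.ψ i x y

      ψ-extends : ∀ x y → InBohr p β z x y → ψ x y ≡ φ x y
      ψ-extends x y h = lookup-ext λ i → trans (lookup∘tabulate _ i) (Coordinate.ψ-extends i x y h)

      assemble : (g : G p n → Fin n → 𝔽) → (∀ i → ∃ λ a → ∃ λ c → ∀ x → g x i ≡ a ∙ x ⊕ c) →
        Σ (Mat p n n) λ A → Σ (G p n) λ c → ∀ x → tabulate (g x) ≡ affApp p A c x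
      assemble g h = A , c , λ x → lookup-ext λ i → begin
        lookup (tabulate (g x)) i ≡⟨ lookup∘tabulate (g x) i ⟩
        g x i ≡⟨ proj₂ (proj₂ (h i)) x ⟩
        proj₁ (h i) ∙ x ⊕ proj₁ (proj₂ (h i)) ≡⟨ sym (cong₂ (λ a c → a ∙ x ⊕ c) (lookup∘tabulate (λ i → proj₁ (h i)) i) (lookup∘tabulate (λ i → proj₁ (proj₂ (h i))) i)) ⟩
        lookup A i ∙ x ⊕ lookup c i ≡⟨ sym (lookup-affApp A c x i) ⟩
        lookup (affApp p A c x) i ∎
        where
          A : Mat p n n
          A = tabulate λ i → proj₁ (h i)
          c : G p n
          c = tabulate λ i → proj₁ (proj₂ (h i))

      ψ-affine : AffineEachVar p (Everywhere p) ψ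
      ψ-affine =
        (λ x → let A , c , eq = assemble (λ y i → Coordinate.ψ i x y) (λ i → Coordinate.ψ-affine-right i x) in A , c , λ y _ → eq y) ,
        (λ y → let A , c , eq = assemble (λ x i → Coordinate.ψ i x y) (λ i → Coordinate.ψ-affine-left i y) in A , c , λ x _ → eq x)

theorem7p7 : (p : ℕ) → Prime p → .{{_ : NonZero p}} → (n k t : ℕ) → 1 ≤ k → 1 ≤ t → 20 * k ≤ t
    → (β : BiAffine p n k) → (z : Vec (F p) k) → BiAffineRank p β t
    → (φ : G p n → G p n → G p n) → AffineEachVar p (InBohr p β z) φ
    → Σ (G p n → G p n → G p n) (λ ψ →
    ((x y : G p n) → InBohr p β z x y → ψ x y ≡ φ x y)
    × AffineEachVar p (Everywhere p) ψ)
theorem7p7 p p-prime n k t 1≤k 1≤t t-large β z (_ , rank) φ affine = ψ , ψ-extends , ψ-affine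
  where
    open OverPrimeField p p-prime
    open Bohr β z 1≤k t-large rank
    open VectorExtension φ affine
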